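{- There is a deterministic online algorithm for the generalized $k$-server problem on weighted uniform metrics with competitive ratio at most $2^{2^{k+3}}$.
   Context: Generalized $k$-server problem: there are $k$ servers $s_1,\dots,s_k$, where server $s_i$ lies in its own metric space $M_i$. Requests arrive online; a request is a $k$-tuple $r=(r_1,\dots,r_k)$ with $r_i\in M_i$, and to serve it the algorithm must move servers so that $s_i$ is at $r_i$ for at least one $i$. The cost is the total distance traveled by all servers. Weighted uniform metric case: each $M_i$ is a uniform metric space in which all pairwise distances equal some $w_i>0$ (the weights $w_i$ may differ across $i$). An online algorithm is $c$-competitive if there is a constant $a$ independent of the request sequence such that for every request sequence $\sigma$, $\mathrm{cost}_{\mathrm{ALG}}(\sigma)\le c\cdot\mathrm{OPT}(\sigma)+a$, with $\mathrm{OPT}(\sigma)$ the optimal offline cost.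
   Formalization: The weights w_i (the pairwise distances in the uniform metric spaces), and hence all costs, are taken to be positive rational numbers instead of arbitrary positive real numbers. -}

module Defs where

open import Data.Nat using (ℕ; zero; suc; _^_)
open import Data.Fin using (Fin; zero; suc)
open import Data.Integer using (+_)
open import Data.Rational using (ℚ; 0ℚ; _+_; _/_)
open import Data.List using (List; []; _∷_)
open import Data.Product using (∃; _,_)
open import Relation.Nullary using (yes; no)
open import Relation.Binary.Definitions using (DecidableEquality)

sumFin : (k : ℕ) → (Fin k → ℚ) → ℚ
sumFin zero    f = 0ℚ
sumFin (suc k) f = f zero + sumFin k (λ i → f (suc i))

-- An instance of the generalized k-server problem on weighted uniform metrics:
-- P i is the point set of the uniform metric space M_i (with decidable
-- equality, needed to compute distances), all distances in M_i equal w i.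
Config : (k : ℕ) → (P : Fin k → Set) → Set
Config k P = (i : Fin k) → P i

Request : (k : ℕ) → (P : Fin k → Set) → Set
Request k P = (i : Fin k) → P i

Serves : (k : ℕ) → (P : Fin k → Set) → Request k P → Config k P → Set
Serves k P r c = ∃ λ i → c i ≡ r i
  where open import Relation.Binary.PropositionalEquality using (_≡_)

dist : (k : ℕ) (P : Fin k → Set) → ((i : Fin k) → DecidableEquality (P i)) →
       (Fin k → ℚ) → (i : Fin k) → P i → P i → ℚ
dist k P eq w i x y with eq i x y
... | yes _ = 0ℚ
... | no  _ = w i

moveCost : (k : ℕ) (P : Fin k → Set) → ((i : Fin k) → DecidableEquality (P i)) →
           (Fin k → ℚ) → Config k P → Config k P → ℚ
moveCost k P eq w c c' = sumFin k (λ i → dist k P eq w i (c i) (c' i))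

pathCost : (k : ℕ) (P : Fin k → Set) → ((i : Fin k) → DecidableEquality (P i)) →
           (Fin k → ℚ) → Config k P → List (Config k P) → ℚ
pathCost k P eq w c []        = 0ℚ
pathCost k P eq w c (c' ∷ cs) = moveCost k P eq w c c' + pathCost k P eq w c' cs

-- A deterministic online algorithm: given the list of past requests
-- (oldest first) and the current request, it outputs the new configuration.
-- Online-ness is enforced by the type: the answer depends only on the past
-- and current requests.  (The algorithm's own previous configurations are a
-- deterministic function of the past requests.)
OnlineAlg : (k : ℕ) → (P : Fin k → Set) → Set
OnlineAlg k P = List (Request k P) → Request k P → Config k P

runFrom : (k : ℕ) (P : Fin k → Set) → OnlineAlg k P →
          List (Request k P) → List (Request k P) → List (Config k P)
runFrom k P A h []      = []
runFrom k P A h (r ∷ σ) = A h r ∷ runFrom k P A (h Data.List.∷ʳ r) σ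
  where import Data.List

run : (k : ℕ) (P : Fin k → Set) → OnlineAlg k P →
      List (Request k P) → List (Config k P)
run k P A σ = runFrom k P A [] σ

ratioBound : ℕ → ℚ
ratioBound k = + (2 ^ (2 ^ (k Data.Nat.+ 3))) / 1
  where import Data.Nat

{-# OPTIONS --safe #-}
module Submission where

-- Let the weights be decreasing.  By induction on the number of spaces, an algorithm for the lighter
-- spaces yields one for all of them, which works in phases.  First the heaviest server rests and the
-- lighter ones serve alone, until every solution without the heaviest server is expensive ("patience").
-- Then only few points p are still candidates, i.e. such that the requests not served by a heaviest
-- server at p have a cheap solution: capacity + 1 such solutions could be merged into one
-- that does not need the heaviest server and is still cheap.  The heaviest server visits the candidates
-- in turn, staying at each one until the remaining requests have become expensive.  After that every
-- solution has either moved the heaviest server or paid as much with the others.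
-- Costs are measured up to a choice of the initial configuration, so that they add up over phases,
-- and are decidable, which lets the algorithm know when a stage is over.

module Discrete where
  open import Data.Nat hiding (_≟_)
  open import Data.Nat.Properties hiding (_≟_)
  open import Data.Nat.Solver using (module +-*-Solver)
  open import Algebra.Properties.CommutativeSemigroup +-commutativeSemigroup using (interchange; x∙yz≈y∙xz)
  open import Data.Bool using (if_then_else_)
  open import Data.List
    using (List; []; _∷_; map; filter; length; zipWith; deduplicate; cartesianProduct; cartesianProductWith)
  open import Data.List.Properties using (length-map; length-take; filter-all; ∷-injective)
  open import Data.List.Membership.Propositional using (_∈_; lose)
  open import Data.List.Membership.Propositional.Properties
    using (∈-map⁺; ∈-cartesianProduct⁺; ∈-cartesianProductWith⁺; ∈-filter⁺; ∈-deduplicate⁺)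
  open import Data.List.Relation.Binary.Pointwise as Pointwise using (Pointwise; []; _∷_)
  open import Data.List.Relation.Binary.Sublist.Propositional using (_⊆_; []; _∷_; _∷ʳ_; ⊆-refl)
  import Data.List.Relation.Binary.Sublist.Propositional.Properties as Sublist
  open import Data.List.Relation.Unary.All as All using (All; []; _∷_)
  import Data.List.Relation.Unary.All.Properties as All
  open import Data.List.Relation.Unary.AllPairs using (AllPairs; []; _∷_)
  open import Data.List.Relation.Unary.Any using (Any; here; there; any?; satisfied)
  open import Data.List.Relation.Unary.Unique.Propositional using (Unique)
  import Data.List.Relation.Unary.Unique.Propositional.Properties as Unique
  import Data.List.Relation.Unary.Unique.DecPropositional.Properties as DecUnique
  open import Data.Maybe using (Maybe; just; nothing)
  open import Data.Product using (Σ; ∃; ∃₂; _×_; _,_; proj₁; proj₂)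
  open import Data.Sum using (_⊎_; inj₁; inj₂)
  open import Data.Unit using (⊤; tt)
  open import Data.Empty using (⊥)
  open import Function using (_∘_)
  open import Relation.Nullary using (Dec; yes; no; does; ¬_; contradiction)
  open import Relation.Nullary.Decidable using (¬?; _×-dec_; _⊎-dec_; map′)
  open import Relation.Binary.Definitions using (DecidableEquality)
  open import Relation.Binary.PropositionalEquality
    using (_≡_; _≢_; refl; sym; trans; cong; cong₂; subst; module ≡-Reasoning)

  -- Uniform metric spaces with natural weights.

  record Space : Set₁ where
    field
      Pt   : Set
      _≟_  : DecidableEquality Pt
      wt   : ℕ
      wt>0 : 0 < wt

  open Space using (Pt; wt; wt>0)

  dst : (X : Space) → Pt X → Pt X → ℕ
  dst X x y = if does (Space._≟_ X x y) then 0 else wt X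

  module _ (X : Space) where
    open Space X using (_≟_)

    dst-refl : ∀ x → dst X x x ≡ 0
    dst-refl x with x ≟ x
    ... | yes _  = refl
    ... | no x≢x = contradiction refl x≢x

    dst-≢ : ∀ {x y} → x ≢ y → dst X x y ≡ wt X
    dst-≢ {x} {y} x≢y with x ≟ y
    ... | yes x≡y = contradiction x≡y x≢y
    ... | no _    = refl

    dst≤wt : ∀ x y → dst X x y ≤ wt X
    dst≤wt x y with x ≟ y
    ... | yes _ = z≤n
    ... | no _  = ≤-refl

    dst-sym : ∀ x y → dst X x y ≡ dst X y x
    dst-sym x y with x ≟ y
    ... | yes refl = sym (dst-refl x)
    ... | no x≢y   = sym (dst-≢ (λ y≡x → x≢y (sym y≡x)))

    dst-triangle : ∀ x y z → dst X x z ≤ dst X x y + dst X y z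
    dst-triangle x y z with x ≟ y
    ... | yes refl = ≤-refl
    ... | no _     = ≤-trans (dst≤wt x z) (m≤m+n (wt X) _)

  -- Costs of paths, from a given or a free starting point.

  module _ {A : Set} (δ : A → A → ℕ) where

    path : A → List A → ℕ
    path a []       = 0
    path a (b ∷ bs) = δ a b + path b bs

    free : List A → ℕ
    free []       = 0
    free (a ∷ as) = path a as

    free≤path : ∀ a as → free as ≤ path a as
    free≤path a []       = z≤n
    free≤path a (b ∷ bs) = m≤n+m _ (δ a b)

    module _ (δ-triangle : ∀ a b c → δ a c ≤ δ a b + δ b c) where

      path-triangle : ∀ a b cs → path a cs ≤ δ a b + path b cs
      path-triangle a b []       = z≤n
      path-triangle a b (c ∷ cs) = begin
        δ a c + path c cs           ≤⟨ +-monoˡ-≤ _ (δ-triangle a b c) ⟩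
        δ a b + δ b c + path c cs   ≡⟨ +-assoc (δ a b) _ _ ⟩
        δ a b + (δ b c + path c cs) ∎
        where open ≤-Reasoning

      path-⊆ : ∀ a {bs cs} → bs ⊆ cs → path a bs ≤ path a cs
      path-⊆ a []         = z≤n
      path-⊆ a (_∷ʳ_ {xs = bs} c sub) = ≤-trans (path-triangle a c bs) (+-monoʳ-≤ (δ a c) (path-⊆ c sub))
      path-⊆ a (_∷_ {x = b} refl sub) = +-monoʳ-≤ (δ a b) (path-⊆ b sub)

      free-⊆ : ∀ {bs cs} → bs ⊆ cs → free bs ≤ free cs
      free-⊆ []         = z≤n
      free-⊆ (_∷ʳ_ {xs = bs} c sub) = ≤-trans (free≤path c bs) (path-⊆ c sub)
      free-⊆ (_∷_ {x = b} refl sub) = path-⊆ b sub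

  module _ {A B : Set} (δ : A → A → ℕ) (ε : B → B → ℕ) (f : A → B) (m : ℕ) where

    -- `P` confines the Lipschitz condition to the visited points: `merge` is stable only between
    -- lists of equal length.
    path-map : (P : A → Set) → (∀ {a b} → P a → P b → ε (f a) (f b) ≤ m * δ a b) →
               ∀ {a as} → P a → All P as → path ε (f a) (map f as) ≤ m * path δ a as
    path-map P f-lip pa []         = z≤n
    path-map P f-lip {a} {b ∷ bs} pa (pb ∷ ps) = begin
      ε (f a) (f b) + path ε (f b) (map f bs) ≤⟨ +-mono-≤ (f-lip pa pb) (path-map P f-lip pb ps) ⟩
      m * δ a b + m * path δ b bs             ≡⟨ *-distribˡ-+ m (δ a b) _ ⟨
      m * (δ a b + path δ b bs)               ∎
      where open ≤-Reasoning

    free-map : (P : A → Set) → (∀ {a b} → P a → P b → ε (f a) (f b) ≤ m * δ a b) →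
               ∀ {as} → All P as → free ε (map f as) ≤ m * free δ as
    free-map P f-lip []        = z≤n
    free-map P f-lip (pa ∷ ps) = path-map P f-lip pa ps

  module _ {A B : Set} (δ : A → A → ℕ) (ε : B → B → ℕ) (f : A → B) where

    free-map-≤ : (∀ a b → ε (f a) (f b) ≤ δ a b) → ∀ as → free ε (map f as) ≤ free δ as
    free-map-≤ f-short as = ≤-trans
      (free-map δ ε f 1 (λ _ → ⊤) (λ _ _ → ≤-trans (f-short _ _) (m≤m+n _ 0)) (All.universal (λ _ → tt) as))
      (≤-reflexive (*-identityˡ _))

  -- Configurations, service and cheap histories.

  Conf : List Space → Set
  Conf []       = ⊤
  Conf (X ∷ Xs) = Pt X × Conf Xs

  Hit : ∀ Xs → Conf Xs → Conf Xs → Set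
  Hit []       _        _        = ⊥
  Hit (X ∷ Xs) (ρ , rs) (q , cs) = q ≡ ρ ⊎ Hit Xs rs cs

  hit? : ∀ Xs r c → Dec (Hit Xs r c)
  hit? []       _        _        = no λ ()
  hit? (X ∷ Xs) (ρ , rs) (q , cs) = Space._≟_ X q ρ ⊎-dec hit? Xs rs cs

  move : ∀ Xs → Conf Xs → Conf Xs → ℕ
  move []       _        _        = 0
  move (X ∷ Xs) (p , cs) (q , ds) = dst X p q + move Xs cs ds

  move-sym : ∀ Xs c d → move Xs c d ≡ move Xs d c
  move-sym []       _        _        = refl
  move-sym (X ∷ Xs) (p , cs) (q , ds) = cong₂ _+_ (dst-sym X p q) (move-sym Xs cs ds)

  move-refl : ∀ Xs c → move Xs c c ≡ 0
  move-refl []       _        = refl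
  move-refl (X ∷ Xs) (p , cs) = cong₂ _+_ (dst-refl X p) (move-refl Xs cs)

  move-triangle : ∀ Xs c d e → move Xs c e ≤ move Xs c d + move Xs d e
  move-triangle []       _        _        _        = z≤n
  move-triangle (X ∷ Xs) (p , cs) (q , ds) (r , es) = ≤-trans
    (+-mono-≤ (dst-triangle X p q r) (move-triangle Xs cs ds es))
    (≤-reflexive (interchange (dst X p q) _ _ _))

  move≤ : ∀ {w} Xs → All (λ Y → wt Y ≤ w) Xs → ∀ c d → move Xs c d ≤ length Xs * w
  move≤ []       []        _        _        = z≤n
  move≤ (X ∷ Xs) (le ∷ les) (p , cs) (q , ds) =
    +-mono-≤ (≤-trans (dst≤wt X p q) le) (move≤ Xs les cs ds)

  -- Histories are newest-first; by symmetry of the metric this does not change costs.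
  Served : ∀ Xs → List (Conf Xs) → List (Conf Xs) → Set
  Served Xs = Pointwise (Hit Xs)

  -- Strict, so that `¬ Cheap` means that every solution costs at least `B`.
  Cheap : ∀ Xs → ℕ → List (Conf Xs) → Set
  Cheap Xs B h = ∃ λ S → Served Xs h S × free (move Xs) S < B

  Pointwise-⊆ : ∀ {A B : Set} {R : A → B → Set} {xs xs′ ys} → xs′ ⊆ xs → Pointwise R xs ys →
                ∃ λ ys′ → ys′ ⊆ ys × Pointwise R xs′ ys′
  Pointwise-⊆ []           []       = [] , [] , []
  Pointwise-⊆ (_ ∷ʳ sub)   (_ ∷ rs) with _ , sub′ , rs′ ← Pointwise-⊆ sub rs = _ , _ ∷ʳ sub′ , rs′
  Pointwise-⊆ (refl ∷ sub) (r ∷ rs) with _ , sub′ , rs′ ← Pointwise-⊆ sub rs = _ , refl ∷ sub′ , r ∷ rs′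

  Cheap-⊆ : ∀ Xs {B g h} → g ⊆ h → Cheap Xs B h → Cheap Xs B g
  Cheap-⊆ Xs sub (S , hits , S<B) with _ , sub′ , hits′ ← Pointwise-⊆ sub hits =
    _ , hits′ , ≤-<-trans (free-⊆ (move Xs) (move-triangle Xs) sub′) S<B

  Cheap-≤ : ∀ Xs {B B′ h} → B ≤ B′ → Cheap Xs B h → Cheap Xs B′ h
  Cheap-≤ Xs B≤B′ (S , hits , S<B) = S , hits , <-≤-trans S<B B≤B′

  -- Cheapness is decidable because servers may be confined to requested points.

  pool : ∀ Xs → List (Conf Xs) → List (Conf Xs)
  pool []       h = tt ∷ []
  pool (X ∷ Xs) h = cartesianProduct (map proj₁ h) (pool Xs (map proj₂ h))

  snap : (X : Space) → List (Pt X) → Pt X → Pt X → Pt X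
  snap X qs d x = if does (any? (Space._≟_ X x) qs) then x else d

  snap-∈ : ∀ X {qs d} → d ∈ qs → ∀ x → snap X qs d x ∈ qs
  snap-∈ X {qs} d∈qs x with any? (Space._≟_ X x) qs
  ... | yes x∈qs = x∈qs
  ... | no  _    = d∈qs

  snap-id : ∀ X {qs d x} → x ∈ qs → snap X qs d x ≡ x
  snap-id X {qs} {x = x} x∈qs with any? (Space._≟_ X x) qs
  ... | yes _   = refl
  ... | no x∉qs = contradiction x∈qs x∉qs

  -- Every map of a uniform space into itself is non-expansive, since distinct points are already at
  -- maximal distance.
  snap-short : ∀ X qs d x y → dst X (snap X qs d x) (snap X qs d y) ≤ dst X x y
  snap-short X qs d x y with Space._≟_ X x y
  ... | yes refl = ≤-reflexive (dst-refl X (snap X qs d x))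
  ... | no _     = dst≤wt X (snap X qs d x) (snap X qs d y)

  retract : ∀ Xs → List (Conf Xs) → Conf Xs → Conf Xs → Conf Xs
  retract []       h _        _        = tt
  retract (X ∷ Xs) h (d , ds) (q , cs) = snap X (map proj₁ h) d q , retract Xs (map proj₂ h) ds cs

  retract-∈ : ∀ Xs {h d} → d ∈ h → ∀ c → retract Xs h d c ∈ pool Xs h
  retract-∈ []       d∈h c       = here refl
  retract-∈ (X ∷ Xs) d∈h (q , cs) =
    ∈-cartesianProduct⁺ (snap-∈ X (∈-map⁺ proj₁ d∈h) q) (retract-∈ Xs (∈-map⁺ proj₂ d∈h) cs)

  retract-hit : ∀ Xs {h d r c} → r ∈ h → Hit Xs r c → Hit Xs r (retract Xs h d c)
  retract-hit (X ∷ Xs) r∈h (inj₁ refl) = inj₁ (snap-id X (∈-map⁺ proj₁ r∈h))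
  retract-hit (X ∷ Xs) r∈h (inj₂ hit)  = inj₂ (retract-hit Xs (∈-map⁺ proj₂ r∈h) hit)

  retract-short : ∀ Xs h d c c′ → move Xs (retract Xs h d c) (retract Xs h d c′) ≤ move Xs c c′
  retract-short []       h _        _        _         = z≤n
  retract-short (X ∷ Xs) h (d , ds) (q , cs) (q′ , cs′) =
    +-mono-≤ (snap-short X (map proj₁ h) d q q′) (retract-short Xs (map proj₂ h) ds cs cs′)

  words : {A : Set} → ℕ → List A → List (List A)
  words zero    as = [] ∷ []
  words (suc n) as = cartesianProductWith _∷_ as (words n as)

  map∈words : {A B C : Set} {R : A → B → Set} {f : B → C} {cs : List C} → (∀ b → f b ∈ cs) →
              ∀ {as bs} → Pointwise R as bs → map f bs ∈ words (length as) cs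
  map∈words f∈cs []       = here refl
  map∈words f∈cs (_ ∷ rs) = ∈-cartesianProductWith⁺ _∷_ (f∈cs _) (map∈words f∈cs rs)

  retract-served : ∀ Xs {h d g S} → (∀ {r} → r ∈ g → r ∈ h) → Served Xs g S →
                   Served Xs g (map (retract Xs h d) S)
  retract-served Xs g⊆h []           = []
  retract-served Xs g⊆h (hit ∷ hits) =
    retract-hit Xs (g⊆h (here refl)) hit ∷ retract-served Xs (λ r∈ → g⊆h (there r∈)) hits

  cheap? : ∀ Xs B h → Dec (Cheap Xs B h)
  cheap? Xs zero    h  = no λ where (_ , _ , ())
  cheap? Xs (suc B) [] = yes ([] , [] , z<s)
  -- The newest request `d` supplies the default for coordinates that are requested nowhere; an
  -- empty history offers none and is treated apart.
  cheap? Xs B h@(d ∷ _) = map′ satisfied confine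
    (any? (λ S → Pointwise.decidable (hit? Xs) h S ×-dec free (move Xs) S <? B) (words (length h) (pool Xs h)))
    where
    confine : Cheap Xs B h →
              Any (λ S → Served Xs h S × free (move Xs) S < B) (words (length h) (pool Xs h))
    confine (S , hits , S<B) = lose (map∈words (retract-∈ Xs (here refl)) hits)
      ( retract-served Xs (λ r∈ → r∈) hits
      , ≤-<-trans (free-map-≤ (move Xs) (move Xs) (retract Xs h d) (retract-short Xs h d) S) S<B )

  -- Merging many solutions into one.

  -- One less than Sylvester's sequence. Merging in `l` spaces takes more than `capacity l * t`
  -- configurations if at most `t` of them fail to hit a request. With `a = capacity l`, a space
  -- without a popular point raises `t` to `suc a * t`, hence the product.
  capacity : ℕ → ℕ
  capacity zero    = 1
  capacity (suc l) = capacity l * suc (capacity l)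

  -- `t` is an upper bound: `missed` may also be spent on a configuration that hits `r`. This spares
  -- deciding whether a tail hits once its head does.
  data Misses (Xs : List Space) (r : Conf Xs) : List (Conf Xs) → ℕ → Set where
    []   : ∀ {t} → Misses Xs r [] t
    met  : ∀ {c E t} → Hit Xs r c → Misses Xs r E t → Misses Xs r (c ∷ E) t
    missed : ∀ {c E t} → Misses Xs r E t → Misses Xs r (c ∷ E) (suc t)

  Misses-≤ : ∀ {Xs r E t u} → t ≤ u → Misses Xs r E t → Misses Xs r E u
  Misses-≤ t≤u       []        = []
  Misses-≤ t≤u       (met x m) = met x (Misses-≤ t≤u m)
  Misses-≤ (s≤s t≤u) (missed m)  = missed (Misses-≤ t≤u m)

  Misses-suc : ∀ {Xs r E t} → Misses Xs r E t → Misses Xs r E (suc t)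
  Misses-suc = Misses-≤ (n≤1+n _)

  Misses-[] : ∀ {r E t} → Misses [] r E t → length E ≤ t
  Misses-[] []       = z≤n
  Misses-[] (missed m) = s≤s (Misses-[] m)

  module _ (X : Space) where
    open Space X using (_≟_)

    count : Pt X → List (Pt X) → ℕ
    count v qs = length (filter (v ≟_) qs)

    count-none : ∀ {v qs} → All (λ q → v ≢ q) qs → count v qs ≡ 0
    count-none []                          = refl
    count-none {v} {q ∷ _} (v≢q ∷ v≢qs) with v ≟ q
    ... | yes v≡q = contradiction v≡q v≢q
    ... | no _    = count-none v≢qs

    count≤ : ∀ {n} v qs → ¬ Any (λ q → n < count q qs) qs → count v qs ≤ n
    count≤ {n} v qs none with any? (v ≟_) qs
    ... | no v∉qs  = ≤-trans (≤-reflexive (count-none (All.¬Any⇒All¬ qs v∉qs))) z≤n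
    ... | yes v∈qs = ≮⇒≥ (λ n<c → none (Any-subst v∈qs n<c))
      where
      Any-subst : ∀ {ps} → Any (v ≡_) ps → n < count v qs → Any (λ q → n < count q qs) ps
      Any-subst (here refl) lt = here lt
      Any-subst (there v∈)  lt = there (Any-subst v∈ lt)

    popular : ℕ → List (Pt X) → Maybe (Pt X)
    popular n qs with any? (λ v → n <? count v qs) qs
    ... | yes any = just (proj₁ (satisfied any))
    ... | no _    = nothing

    popular-just : ∀ {n v} qs → popular n qs ≡ just v → n < count v qs
    popular-just {n} qs eq with any? (λ v → n <? count v qs) qs
    popular-just qs refl | yes any = proj₂ (satisfied any)

    popular-nothing : ∀ {n} v qs → popular n qs ≡ nothing → count v qs ≤ n
    popular-nothing {n} v qs eq with any? (λ v → n <? count v qs) qs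
    ... | no none = count≤ v qs none

    module _ {Xs : List Space} where

      class : Pt X → List (Conf (X ∷ Xs)) → List (Conf Xs)
      class v E = map proj₂ (filter (λ c → v ≟ proj₁ c) E)

      length-class : ∀ v E → length (class v E) ≡ count v (map proj₁ E)
      length-class v []            = refl
      length-class v ((q , cs) ∷ E) with v ≟ q
      ... | yes _ = cong suc (length-class v E)
      ... | no _  = length-class v E

      Misses-class : ∀ {v ρ rs E t} → v ≢ ρ → Misses (X ∷ Xs) (ρ , rs) E t → Misses Xs rs (class v E) t
      Misses-class v≢ρ [] = []
      Misses-class {v} {E = (q , cs) ∷ E} v≢ρ (met h m) with v ≟ q | h
      ... | yes refl | inj₁ v≡ρ = contradiction v≡ρ v≢ρ
      ... | yes _    | inj₂ h′  = met h′ (Misses-class v≢ρ m)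
      ... | no _     | _        = Misses-class v≢ρ m
      Misses-class {v} {E = (q , cs) ∷ E} v≢ρ (missed m) with v ≟ q
      ... | yes _ = missed (Misses-class v≢ρ m)
      ... | no _  = Misses-suc (Misses-class v≢ρ m)

      -- Dropping the first space can create failures only among the members with head `ρ`, and
      -- `count` bounds their number.
      Misses-tails : ∀ {ρ rs E t} → Misses (X ∷ Xs) (ρ , rs) E t →
                     Misses Xs rs (map proj₂ E) (t + count ρ (map proj₁ E))
      Misses-tails [] = []
      Misses-tails {ρ} {E = (q , cs) ∷ E} {t} (met h m) with ρ ≟ q | h
      ... | yes refl | _        = subst (Misses Xs _ _) (sym (+-suc t _)) (missed (Misses-tails m))
      ... | no ρ≢q   | inj₁ q≡ρ = contradiction (sym q≡ρ) ρ≢q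
      ... | no ρ≢q   | inj₂ h′  = met h′ (Misses-tails m)
      Misses-tails {ρ} {E = (q , cs) ∷ E} (missed {t = t} m) with ρ ≟ q
      ... | yes _ = subst (Misses Xs _ _) (cong suc (sym (+-suc t _))) (Misses-suc (missed (Misses-tails m)))
      ... | no _  = missed (Misses-tails m)

  -- A point occupied by many configurations is kept; if there is none, each request hits few of the
  -- configurations in the space X, which can then be ignored at the price of a larger t.
  merge : ∀ Xs → ℕ → Conf Xs → List (Conf Xs) → Conf Xs
  merge []       t d        E = tt
  merge (X ∷ Xs) t (d , ds) E
    with popular X (capacity (length Xs) * t) (map proj₁ E)
  ... | just v  = v , merge Xs t ds (class X v E)
  ... | nothing = d , merge Xs (t + capacity (length Xs) * t) ds (map proj₂ E)

  -- If a popular `v` does not itself hit, its class is still large enough for the same `t`. Without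
  -- a popular point at most `a * t` members hit in `X`, so the tails have at most `suc a * t`
  -- failures, which the recursion of `capacity` absorbs.
  merge-hit : ∀ Xs {t d r E} → Misses Xs r E t → capacity (length Xs) * t < length E →
              Hit Xs r (merge Xs t d E)
  merge-hit [] {t} m long = contradiction (Misses-[] m)
    (<⇒≱ (≤-<-trans (≤-reflexive (sym (*-identityˡ t))) long))
  merge-hit (X ∷ Xs) {t} {E = E} m long
    with popular X (capacity (length Xs) * t) (map proj₁ E) in eq
  merge-hit (X ∷ Xs) {r = ρ , rs} {E} m long | just v with Space._≟_ X v ρ
  ... | yes v≡ρ = inj₁ v≡ρ
  ... | no v≢ρ  = inj₂ (merge-hit Xs (Misses-class X v≢ρ m)
                    (<-≤-trans (popular-just X (map proj₁ E) eq) (≤-reflexive (sym (length-class X v E)))))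
  merge-hit (X ∷ Xs) {t} {r = ρ , rs} {E} m long | nothing =
    inj₂ (merge-hit Xs
      (Misses-≤ (+-monoʳ-≤ t (popular-nothing X ρ (map proj₁ E) eq)) (Misses-tails X m))
      (begin-strict
        a * (suc a * t) ≡⟨ *-assoc a (suc a) t ⟨
        a * suc a * t   <⟨ long ⟩
        length E        ≡⟨ length-map proj₂ E ⟨
        length (map proj₂ E) ∎))
    where
    open ≤-Reasoning
    a = capacity (length Xs)

  moves : ∀ Xs → List (Conf Xs) → List (Conf Xs) → ℕ
  moves Xs (c ∷ E) (c′ ∷ E′) = move Xs c c′ + moves Xs E E′
  moves Xs _       _         = 0

  module _ (X : Space) (Xs : List Space) where
    open Space X using (_≟_)

    moves-class : ∀ v E E′ → map proj₁ E ≡ map proj₁ E′ →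
                  moves Xs (class X v E) (class X v E′) ≤ moves (X ∷ Xs) E E′
    moves-class v []             []              _  = z≤n
    moves-class v ((q , cs) ∷ E) ((q′ , cs′) ∷ E′) eq with refl , eqs ← ∷-injective eq with v ≟ q
    ... | yes _ = +-mono-≤ (m≤n+m (move Xs cs cs′) (dst X q q)) (moves-class v E E′ eqs)
    ... | no _  = ≤-trans (moves-class v E E′ eqs) (m≤n+m _ (move (X ∷ Xs) (q , cs) (q , cs′)))

    moves-tails : ∀ E E′ → moves Xs (map proj₂ E) (map proj₂ E′) ≤ moves (X ∷ Xs) E E′
    moves-tails []             _                 = z≤n
    moves-tails (_ ∷ _)        []                = z≤n
    moves-tails ((q , cs) ∷ E) ((q′ , cs′) ∷ E′) =
      +-mono-≤ (m≤n+m (move Xs cs cs′) (dst X q q′)) (moves-tails E E′)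

    heads-move : ∀ E E′ → length E ≡ length E′ → map proj₁ E ≡ map proj₁ E′ ⊎ wt X ≤ moves (X ∷ Xs) E E′
    heads-move []             []                _  = inj₁ refl
    heads-move ((q , cs) ∷ E) ((q′ , cs′) ∷ E′) eq with q ≟ q′ | heads-move E E′ (suc-injective eq)
    ... | no _     | _       = inj₂ (≤-trans (m≤m+n (wt X) _) (m≤m+n (wt X + _) _))
    ... | yes refl | inj₁ eqs = inj₁ (cong (q ∷_) eqs)
    ... | yes refl | inj₂ le = inj₂ (≤-trans le (m≤n+m _ (move Xs cs cs′)))

  Descending : List Space → Set₁
  Descending = AllPairs (λ X Y → wt Y ≤ wt X)

  -- If some head moves, `moves` already contains the largest weight, and the factor, the number of
  -- spaces, pays for moving every server. If all heads rest, both mergers take the same branch and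
  -- the same point, so only the remaining spaces matter.
  merge-stable : ∀ Xs → Descending Xs → ∀ t d {E E′} → length E ≡ length E′ →
                 move Xs (merge Xs t d E) (merge Xs t d E′) ≤ length Xs * moves Xs E E′
  merge-stable []       []             t d _ = z≤n
  merge-stable (X ∷ Xs) (X≥Xs ∷ desc) t (d , ds) {E} {E′} same-length with heads-move X Xs E E′ same-length
  ... | inj₂ moved = ≤-trans (move≤ (X ∷ Xs) (≤-refl ∷ X≥Xs) (merge (X ∷ Xs) t (d , ds) E) _)
                             (*-monoʳ-≤ (suc (length Xs)) moved)
  ... | inj₁ heads≡ rewrite heads≡
    with popular X (capacity (length Xs) * t) (map proj₁ E′)
  ... | nothing rewrite dst-refl X d = begin
    move Xs (merge Xs _ ds (map proj₂ E)) (merge Xs _ ds (map proj₂ E′))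
      ≤⟨ merge-stable Xs desc _ ds (trans (length-map proj₂ E) (trans same-length (sym (length-map proj₂ E′)))) ⟩
    length Xs * moves Xs (map proj₂ E) (map proj₂ E′)
      ≤⟨ *-mono-≤ (n≤1+n (length Xs)) (moves-tails X Xs E E′) ⟩
    suc (length Xs) * moves (X ∷ Xs) E E′ ∎
    where open ≤-Reasoning
  ... | just v rewrite dst-refl X v = begin
    move Xs (merge Xs t ds (class X v E)) (merge Xs t ds (class X v E′))
      ≤⟨ merge-stable Xs desc t ds (trans (length-class X v E)
           (trans (cong (count X v) heads≡) (sym (length-class X v E′)))) ⟩
    length Xs * moves Xs (class X v E) (class X v E′)
      ≤⟨ *-mono-≤ (n≤1+n (length Xs)) (moves-class X Xs v E E′ heads≡) ⟩
    suc (length Xs) * moves (X ∷ Xs) E E′ ∎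
    where open ≤-Reasoning

  -- Candidate points for the heaviest server.

  module _ (X : Space) (Xs : List Space) where
    open Space X using (_≟_)

    -- The requests left to the lighter servers while the heaviest one stays at p.
    off : Pt X → List (Conf (X ∷ Xs)) → List (Conf Xs)
    off p h = map proj₂ (filter (λ r → ¬? (proj₁ r ≟ p)) h)

    off-⊆ : ∀ p {g h} → g ⊆ h → off p g ⊆ off p h
    off-⊆ p g⊆h = Sublist.map⁺ proj₂
      (Sublist.filter⁺ _ _ (λ where refl q≢p → q≢p) g⊆h)

    off-∉ : ∀ p h → All (λ q → ¬ p ≡ q) (map proj₁ h) → off p h ≡ map proj₂ h
    off-∉ p h p∉h = cong (map proj₂)
      (filter-all (λ r → ¬? (proj₁ r ≟ p)) (All.map (λ p≢q q≡p → p≢q (sym q≡p)) (All.map⁻ p∉h)))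

    Costly : List (Conf (X ∷ Xs)) → Pt X → Set
    Costly h p = ¬ Cheap Xs (wt X) (off p h)

    Costly-⊆ : ∀ {g h p} → g ⊆ h → Costly g p → Costly h p
    Costly-⊆ {p = p} g⊆h costly cheap = costly (Cheap-⊆ Xs (off-⊆ p g⊆h) cheap)

    HitAll : List (Pt X) → Conf (X ∷ Xs) → List (Conf Xs) → Set
    HitAll ps r E = Pointwise (λ p c → Hit (X ∷ Xs) r (p , c)) ps E

    -- At a request with heaviest coordinate `p` the lighter servers repeat their place `s`, which
    -- is free.
    hold : ∀ p h {S} → Served Xs (off p h) S → ∀ s →
           ∃ λ T → Pointwise (λ r c → Hit (X ∷ Xs) r (p , c)) h T × path (move Xs) s T ≤ path (move Xs) s S
    hold p [] [] s = [] , [] , z≤n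
    hold p ((ρ , rs) ∷ h) hits s with ρ ≟ p
    ... | yes refl with T , hits′ , T≤S ← hold p h hits s =
      s ∷ T , inj₁ refl ∷ hits′ , ≤-trans (≤-reflexive (cong (_+ path (move Xs) s T) (move-refl Xs s))) T≤S
    hold p ((ρ , rs) ∷ h) (_∷_ {y = c} x hits) s | no _ with T , hits′ , T≤S ← hold p h hits c =
      c ∷ T , inj₂ x ∷ hits′ , +-monoʳ-≤ (move Xs s c) T≤S

    hold-free : ∀ p h {S} → Served Xs (off p h) S →
                ∃ λ T → Pointwise (λ r c → Hit (X ∷ Xs) r (p , c)) h T × free (move Xs) T ≤ free (move Xs) S
    hold-free p [] [] = [] , [] , z≤n
    hold-free p (r ∷ h) {S} hits = from S hits
      where
      from : ∀ S → Served Xs (off p (r ∷ h)) S →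
             ∃ λ T → Pointwise (λ r c → Hit (X ∷ Xs) r (p , c)) (r ∷ h) T × free (move Xs) T ≤ free (move Xs) S
      from [] hits with T , hits′ , T≤S ← hold p (r ∷ h) hits (proj₂ r) =
        T , hits′ , ≤-trans (free≤path (move Xs) (proj₂ r) T) T≤S
      from (c ∷ S) hits with T , hits′ , T≤S ← hold p (r ∷ h) hits c =
        T , hits′ , ≤-trans (free≤path (move Xs) c T)
          (≤-trans T≤S (≤-reflexive (cong (_+ path (move Xs) c S) (move-refl Xs c))))

    path-zip : ∀ c E T U → path (moves Xs) (c ∷ E) (zipWith _∷_ T U) ≤ path (move Xs) c T + path (moves Xs) E U
    path-zip c E []      U        = z≤n
    path-zip c E (_ ∷ _) []       = z≤n
    path-zip c E (t ∷ T) (u ∷ U) = ≤-trans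
      (+-monoʳ-≤ (move Xs c t + moves Xs E u) (path-zip t u T U))
      (≤-reflexive (interchange (move Xs c t) _ _ _))

    free-zip : ∀ T U → free (moves Xs) (zipWith _∷_ T U) ≤ free (move Xs) T + free (moves Xs) U
    free-zip []      U       = z≤n
    free-zip (_ ∷ _) []      = z≤n
    free-zip (c ∷ T) (E ∷ U) = path-zip c E T U

    path-[] : ∀ (h : List (Conf (X ∷ Xs))) → path (moves Xs) [] (map (λ _ → []) h) ≡ 0
    path-[] []      = refl
    path-[] (_ ∷ h) = path-[] h

    -- The solutions for the points `ps` run side by side, each padded by `hold-free` to the full
    -- history, so that every request meets one configuration per point.
    together : ∀ h {ps} → All (λ p → Cheap Xs (wt X) (off p h)) ps →
               ∃ λ U → Pointwise (HitAll ps) h U × free (moves Xs) U ≤ length ps * wt X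
    together h [] = map (λ _ → []) h , none h , ≤-reflexive (free-[] h)
      where
      none : ∀ h → Pointwise (HitAll []) h (map (λ _ → []) h)
      none []      = []
      none (_ ∷ h) = [] ∷ none h
      free-[] : ∀ h → free (moves Xs) (map (λ _ → []) h) ≡ 0
      free-[] []      = refl
      free-[] (_ ∷ h) = path-[] h
    together h {p ∷ _} ((S , hits , S<w) ∷ cheap)
      with T , hitsT , T≤S ← hold-free p h hits
         | U , hitsU , U≤ ← together h cheap =
      zipWith _∷_ T U , zip hitsT hitsU ,
      ≤-trans (free-zip T U) (+-mono-≤ (≤-trans T≤S (<⇒≤ S<w)) U≤)
      where
      zip : ∀ {h T U ps} → Pointwise (λ r c → Hit (X ∷ Xs) r (p , c)) h T → Pointwise (HitAll ps) h U →
            Pointwise (HitAll (p ∷ ps)) h (zipWith _∷_ T U)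
      zip []         []           = []
      zip (x ∷ hs) (hitall ∷ hss) = (x ∷ hitall) ∷ zip hs hss

    HitAll⇒Misses-0 : ∀ {ρ rs ps E} → All (λ p → ¬ ρ ≡ p) ps → HitAll ps (ρ , rs) E → Misses Xs rs E 0
    HitAll⇒Misses-0 []           []                = []
    HitAll⇒Misses-0 (ρ≢p ∷ _)    (inj₁ p≡ρ ∷ _)    = contradiction (sym p≡ρ) ρ≢p
    HitAll⇒Misses-0 (_ ∷ ρ≢ps)   (inj₂ h ∷ hits)   = met h (HitAll⇒Misses-0 ρ≢ps hits)

    -- At most one of the distinct points is the heaviest coordinate of the request; all other
    -- members must hit it in the lighter spaces.
    HitAll⇒Misses-1 : ∀ {ρ rs ps E} → Unique ps → HitAll ps (ρ , rs) E → Misses Xs rs E 1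
    HitAll⇒Misses-1 []            []                 = []
    HitAll⇒Misses-1 (p≢ps ∷ _)    (inj₁ refl ∷ hits) = missed (HitAll⇒Misses-0 p≢ps hits)
    HitAll⇒Misses-1 (_ ∷ unique)  (inj₂ h ∷ hits)    = met h (HitAll⇒Misses-1 unique hits)

    -- Bounds the cost of a merger of capacity + 1 solutions, each of cost less than wt X.
    patience : ℕ
    patience = suc (length Xs) * (suc (capacity (length Xs)) * wt X)

    wt≤patience : wt X ≤ patience
    wt≤patience = ≤-trans (m≤m+n (wt X) _) (m≤m+n _ _)

    0<patience : 0 < patience
    0<patience = <-≤-trans (wt>0 X) wt≤patience

    -- Merging with `t = 1` takes more than `capacity` solutions. By `merge-stable` the merger moves
    -- at most `length Xs` times as far as all of them together.
    merged-cheap : Descending Xs → ∀ h {ps} → Unique ps → length ps ≡ suc (capacity (length Xs)) →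
                   All (λ p → Cheap Xs (wt X) (off p h)) ps → Cheap Xs patience (map proj₂ h)
    merged-cheap desc [] _ _ _ = [] , [] , 0<patience
    merged-cheap desc h@(r ∷ _) {ps} unique len cheap with U , hits , U≤ ← together h cheap =
      map f U , served hits , (begin-strict
        free (move Xs) (map f U)
          ≤⟨ free-map (moves Xs) (move Xs) f (length Xs) (λ E → length E ≡ length ps)
               (λ E≡ E′≡ → merge-stable Xs desc 1 (proj₂ r) (trans E≡ (sym E′≡))) (lengths hits) ⟩
        length Xs * free (moves Xs) U
          ≤⟨ *-monoʳ-≤ (length Xs) (≤-trans U≤ (≤-reflexive (cong (_* wt X) len))) ⟩
        length Xs * (suc (capacity (length Xs)) * wt X)
          -- The factor `suc (length Xs)` in `patience` leaves one surplus summand, which makes the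
          -- bound strict.
          <⟨ m<n+m _ (<-≤-trans (wt>0 X) (m≤m+n (wt X) _)) ⟩
        patience ∎)
      where
      open ≤-Reasoning
      f : List (Conf Xs) → Conf Xs
      f = merge Xs 1 (proj₂ r)
      lengths : ∀ {h U} → Pointwise (HitAll ps) h U → All (λ E → length E ≡ length ps) U
      lengths []           = []
      lengths (hits ∷ hss) = sym (Pointwise.Pointwise-length hits) ∷ lengths hss
      served : ∀ {h U} → Pointwise (HitAll ps) h U → Served Xs (map proj₂ h) (map f U)
      served []           = []
      served (hits ∷ hss) = merge-hit Xs (HitAll⇒Misses-1 unique hits)
        (≤-reflexive (trans (cong suc (*-identityʳ _)) (trans (sym len) (Pointwise.Pointwise-length hits))))
        ∷ served hss

    candidates : List (Conf (X ∷ Xs)) → List (Pt X)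
    candidates h = filter (λ p → cheap? Xs (wt X) (off p h)) (deduplicate _≟_ (map proj₁ h))

    candidates-few : Descending Xs → ∀ h → ¬ Cheap Xs patience (map proj₂ h) →
                     length (candidates h) ≤ capacity (length Xs)
    candidates-few desc h dear = ≮⇒≥ λ many → dear (merged-cheap desc h
      (Unique.take⁺ m (Unique.filter⁺ cheapOff? (DecUnique.deduplicate-! _≟_ (map proj₁ h))))
      (trans (length-take m (candidates h)) (m≤n⇒m⊓n≡m many))
      (All.take⁺ m (All.all-filter cheapOff? (deduplicate _≟_ (map proj₁ h)))))
      where
      m = suc (capacity (length Xs))
      cheapOff? = λ p → cheap? Xs (wt X) (off p h)

    -- Searching the requested points is enough: at any other point the heaviest server serves
    -- nothing, so a cheap solution there would serve all of `map proj₂ h` for less than `wt X`,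
    -- contrary to `dear`.
    candidates-complete : ∀ h → ¬ Cheap Xs patience (map proj₂ h) → ∀ p → Costly h p ⊎ p ∈ candidates h
    candidates-complete h dear p with cheap? Xs (wt X) (off p h)
    ... | no costly = inj₁ costly
    ... | yes cheap with any? (p ≟_) (map proj₁ h)
    ... | yes p∈h = inj₂ (∈-filter⁺ (λ p → cheap? Xs (wt X) (off p h)) (∈-deduplicate⁺ _≟_ p∈h) cheap)
    ... | no p∉h  = contradiction
      (Cheap-≤ Xs wt≤patience (subst (Cheap Xs (wt X)) (off-∉ p h (All.¬Any⇒All¬ _ p∉h)) cheap)) dear

    heavy-rests : ∀ s S → path (move (X ∷ Xs)) s S < wt X → All (λ c → proj₁ c ≡ proj₁ s) S
    heavy-rests s [] _ = []
    heavy-rests (p , cs) ((q , ds) ∷ S) S<w with p ≟ q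
    ... | no _     = contradiction (≤-trans (m≤m+n (wt X) (move Xs cs ds)) (m≤m+n _ _)) (<⇒≱ S<w)
    ... | yes refl = refl ∷ heavy-rests (p , ds) S (≤-<-trans (m≤n+m _ (move Xs cs ds)) S<w)

    off-served : ∀ p {h S} → Served (X ∷ Xs) h S → All (λ c → proj₁ c ≡ p) S →
                 ∃ λ S′ → S′ ⊆ map proj₂ S × Served Xs (off p h) S′
    off-served p [] [] = [] , [] , []
    off-served p {(ρ , rs) ∷ h} {(q , cs) ∷ S} (x ∷ hits) (q≡p ∷ S≡p)
      with S′ , sub , hits′ ← off-served p hits S≡p with ρ ≟ p | x
    ... | yes _  | _        = S′ , cs ∷ʳ sub , hits′
    ... | no ρ≢p | inj₁ q≡ρ = contradiction (trans (sym q≡ρ) q≡p) ρ≢p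
    ... | no _   | inj₂ h′  = cs ∷ S′ , refl ∷ sub , h′ ∷ hits′

    -- Either the heavy server moves, or it rests at some p and the others pay.
    costly⇒wt≤free : ∀ {r h S} → (∀ p → Costly (r ∷ h) p) → Served (X ∷ Xs) (r ∷ h) S →
                     wt X ≤ free (move (X ∷ Xs)) S
    costly⇒wt≤free {S = c ∷ S} costly hits = ≮⇒≥ λ S<w →
      let S′ , sub , hits′ = off-served (proj₁ c) hits (refl ∷ heavy-rests c S S<w)
      in costly (proj₁ c) (S′ , hits′ , (begin-strict
        free (move Xs) S′                   ≤⟨ free-⊆ (move Xs) (move-triangle Xs) sub ⟩
        free (move Xs) (map proj₂ (c ∷ S))  ≤⟨ free-map-≤ (move (X ∷ Xs)) (move Xs) proj₂
                                                 (λ a b → m≤n+m _ (dst X (proj₁ a) (proj₁ b))) (c ∷ S) ⟩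
        free (move (X ∷ Xs)) (c ∷ S)        <⟨ S<w ⟩
        wt X                                ∎))
      where open ≤-Reasoning

  -- Online algorithms as step machines.

  -- State h c y: after the history h the configuration is c and at most y may still be spent.
  record Machine (Xs : List Space) (Bad : List (Conf Xs) → Set) (D : ℕ) : Set₁ where
    field
      State : List (Conf Xs) → Conf Xs → ℕ → Set
      start : ∀ c → State [] c D
      step  : ∀ {h c y} → State h c y → ∀ r →
              (∃₂ λ c′ y′ → Hit Xs r c′ × move Xs c c′ + y′ ≤ y × State (r ∷ h) c′ y′) ⊎ Bad (r ∷ h)

  -- State h c x: after the history h the configuration is c and x has been spent.
  record Forever (Xs : List Space) (e W : ℕ) : Set₁ where
    field
      State : List (Conf Xs) → Conf Xs → ℕ → Set
      start : ∀ c → State [] c 0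
      -- Without spaces no request can be served; the premise `∃ (Hit Xs r)` lets the induction
      -- start there.
      step  : ∀ {h c x} → State h c x → ∀ r → ∃ (Hit Xs r) →
              ∃ λ c′ → Hit Xs r c′ × State (r ∷ h) c′ (x + move Xs c c′)
      bound : ∀ {h c x S} → State h c x → Served Xs h S → x ≤ e * (free (move Xs) S + W)

  module _ {Xs : List Space} where

    relax : ∀ {B B′ D} → (∀ {h} → B h → B′ h) → Machine Xs B D → Machine Xs B′ D
    relax {B′ = B′} B⇒B′ M = record { State = State ; start = start ; step = step′ }
      where
      open Machine M
      step′ : ∀ {h c y} → State h c y → ∀ r →
              (∃₂ λ c′ y′ → Hit Xs r c′ × move Xs c c′ + y′ ≤ y × State (r ∷ h) c′ y′) ⊎ B′ (r ∷ h)
      step′ s r with step s r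
      ... | inj₁ response = inj₁ response
      ... | inj₂ bad      = inj₂ (B⇒B′ bad)

    endow : ∀ {B D D′} → D ≤ D′ → Machine Xs B D → Machine Xs B D′
    endow {B} {D} {D′} D≤D′ M = record { State = State′ ; start = λ c → D , D≤D′ , start c ; step = step′ }
      where
      open Machine M
      State′ : List (Conf Xs) → Conf Xs → ℕ → Set
      State′ h c y = ∃ λ y₀ → y₀ ≤ y × State h c y₀
      step′ : ∀ {h c y} → State′ h c y → ∀ r →
              (∃₂ λ c′ y′ → Hit Xs r c′ × move Xs c c′ + y′ ≤ y × State′ (r ∷ h) c′ y′) ⊎ B (r ∷ h)
      step′ (y₀ , y₀≤y , s) r with step s r
      ... | inj₁ (c′ , y′ , x , cost , s′) = inj₁ (c′ , y′ , x , ≤-trans cost y₀≤y , y′ , ≤-refl , s′)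
      ... | inj₂ bad                       = inj₂ bad

  -- Join g₁ g₂ h: h is g₁ followed in time by g₂, the newest element of g₁ being the oldest of g₂.
  data Join {A : Set} : List A → List A → List A → Set where
    turn : ∀ {a as} → Join (a ∷ as) (a ∷ []) (a ∷ as)
    next : ∀ {a as bs cs} → Join as bs cs → Join as (a ∷ bs) (a ∷ cs)

  module _ {A : Set} where

    Join-⊆ˡ : ∀ {as bs cs : List A} → Join as bs cs → as ⊆ cs
    Join-⊆ˡ turn     = ⊆-refl
    Join-⊆ˡ (next j) = _ ∷ʳ Join-⊆ˡ j

    Join-⊆ʳ : ∀ {as bs cs : List A} → Join as bs cs → bs ⊆ cs
    Join-⊆ʳ turn     = refl ∷ Sublist.[]⊆-universal _
    Join-⊆ʳ (next j) = refl ∷ Join-⊆ʳ j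

    -- The shared element is an end of both paths, so no move between them is lost.
    Join-free : ∀ δ {as bs cs : List A} → Join as bs cs → free δ as + free δ bs ≡ free δ cs
    Join-free δ turn                 = +-identityʳ _
    Join-free δ (next {a} (turn {b} {as}))  = trans (+-comm _ (δ a b + 0)) (cong (_+ path δ b as) (+-identityʳ _))
    Join-free δ (next {a} {as} (next {b} {bs = bs} {cs} j)) = begin
      free δ as + (δ a b + path δ b bs) ≡⟨ x∙yz≈y∙xz (free δ as) (δ a b) _ ⟩
      δ a b + (free δ as + path δ b bs) ≡⟨ cong (δ a b +_) (Join-free δ (next {a = b} j)) ⟩
      δ a b + path δ b cs               ∎
      where
      open ≡-Reasoning

  Join-Pointwise : ∀ {A B : Set} {R : A → B → Set} {as bs cs S} → Join as bs cs → Pointwise R cs S →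
                   ∃₂ λ S₁ S₂ → Join S₁ S₂ S × Pointwise R as S₁ × Pointwise R bs S₂
  Join-Pointwise turn     (r ∷ rs) = _ , _ , turn , r ∷ rs , r ∷ []
  Join-Pointwise (next j) (r ∷ rs) with _ , _ , j′ , rs₁ , rs₂ ← Join-Pointwise j rs =
    _ , _ , next j′ , rs₁ , r ∷ rs₂

  module _ {Xs : List Space} {B₁ B : List (Conf Xs) → Set} {D₁ D₂ : ℕ} where

    -- The request that makes the first machine bad is not yet served; the second one starts with
    -- it, hence the overlap in `Join`. During the first stage `D₂` is held in reserve. The second
    -- machine may depend on the history `g` that ended the first stage.
    _then_ : Machine Xs B₁ D₁ →
             (∀ {g} → B₁ g → Machine Xs (λ g′ → ∀ {h} → Join g g′ h → B h) D₂) →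
             Machine Xs B (D₁ + D₂)
    M then N = record { State = State ; start = λ c → inj₁ (D₁ , ≤-refl , M.start c) ; step = step }
      where
      module M = Machine M
      module N {g} (bad : B₁ g) = Machine (N bad)
      State : List (Conf Xs) → Conf Xs → ℕ → Set
      State h c y = (∃ λ y₁ → y₁ + D₂ ≤ y × M.State h c y₁)
                  ⊎ (∃₂ λ g g′ → Σ (B₁ g) λ bad → Join g g′ h × N.State bad g′ c y)
      step : ∀ {h c y} → State h c y → ∀ r →
             (∃₂ λ c′ y′ → Hit Xs r c′ × move Xs c c′ + y′ ≤ y × State (r ∷ h) c′ y′) ⊎ B (r ∷ h)
      step {c = c} (inj₁ (y₁ , y₁≤y , s)) r with M.step s r
      ... | inj₁ (c′ , y′ , x , cost , s′) =
        inj₁ (c′ , y′ + D₂ , x ,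
              ≤-trans (≤-reflexive (sym (+-assoc (move Xs c c′) y′ D₂))) (≤-trans (+-monoˡ-≤ D₂ cost) y₁≤y) ,
              inj₁ (y′ , ≤-refl , s′))
      ... | inj₂ bad with N.step bad (N.start bad c) r
      ... | inj₁ (c′ , y′ , x , cost , s′) =
        inj₁ (c′ , y′ , x , ≤-trans cost (≤-trans (m≤n+m D₂ y₁) y₁≤y) , inj₂ (_ , _ , bad , turn , s′))
      ... | inj₂ bad′ = inj₂ (bad′ turn)
      step (inj₂ (g , g′ , bad , j , s)) r with N.step bad s r
      ... | inj₁ (c′ , y′ , x , cost , s′) = inj₁ (c′ , y′ , x , cost , inj₂ (_ , _ , bad , next j , s′))
      ... | inj₂ bad′ = inj₂ (bad′ (next j))

  -- While some solution is cheaper than `B`, `bound` applied to it keeps the spending within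
  -- `e * (B + W)`; `cheap?` detects the end.
  truncate : ∀ {Xs e W} B → 0 < B → Forever Xs e W → Machine Xs (λ h → ¬ Cheap Xs B h) (e * (B + W))
  truncate {Xs} {e} {W} B 0<B F = record
    { State = State′ ; start = λ c → 0 , refl , ([] , [] , 0<B) , start c ; step = step′ }
    where
    open Forever F
    D = e * (B + W)
    State′ : List (Conf Xs) → Conf Xs → ℕ → Set
    State′ h c y = ∃ λ x → x + y ≡ D × Cheap Xs B h × State h c x
    step′ : ∀ {h c y} → State′ h c y → ∀ r →
            (∃₂ λ c′ y′ → Hit Xs r c′ × move Xs c c′ + y′ ≤ y × State′ (r ∷ h) c′ y′) ⊎ ¬ Cheap Xs B (r ∷ h)
    step′ {h} {c} {y} (x , x+y≡D , _ , s) r with cheap? Xs B (r ∷ h)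
    ... | no dear = inj₂ dear
    -- The newest configuration `d` of the cheap solution shows that `r` can be served, as
    -- `Forever.step` demands.
    ... | yes cheap@(d ∷ S , hit ∷ hits , S<B) with c′ , hit′ , s′ ← step s r (d , hit) =
      inj₁ (c′ , D ∸ x′ , hit′ ,
            ≤-reflexive (+-cancelˡ-≡ x _ _ (trans (sym (+-assoc x _ _)) (trans x′+rest (sym x+y≡D)))) ,
            x′ , x′+rest , cheap , s′)
      where
      x′ = x + move Xs c c′
      x′+rest : x′ + (D ∸ x′) ≡ D
      x′+rest = m+[n∸m]≡n (≤-trans (bound s′ (hit ∷ hits)) (*-monoʳ-≤ e (+-monoˡ-≤ W (<⇒≤ S<B))))

  -- Phases and their repetition.

  module _ (X : Space) {Xs : List Space} where
    open Space X using (_≟_)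

    ignoring : ∀ {B D} → Machine Xs B D → Machine (X ∷ Xs) (B ∘ map proj₂) D
    ignoring {B} {D} M = record { State = State′ ; start = start ∘ proj₂ ; step = step′ }
      where
      open Machine M
      State′ : List (Conf (X ∷ Xs)) → Conf (X ∷ Xs) → ℕ → Set
      State′ h (p , cs) y = State (map proj₂ h) cs y
      step′ : ∀ {h c y} → State′ h c y → ∀ r →
              (∃₂ λ c′ y′ → Hit (X ∷ Xs) r c′ × move (X ∷ Xs) c c′ + y′ ≤ y × State′ (r ∷ h) c′ y′)
              ⊎ B (map proj₂ (r ∷ h))
      step′ {c = p , cs} s (_ , rs) with step s rs
      ... | inj₂ bad = inj₂ bad
      ... | inj₁ (cs′ , y′ , x , cost , s′) = inj₁ ((p , cs′) , y′ , inj₂ x ,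
        ≤-trans (≤-reflexive (cong (λ z → z + move Xs cs cs′ + y′) (dst-refl X p))) cost , s′)

    -- The move to `p` is made while serving the first request; until then its cost `dst X q p` is
    -- held in reserve, covered by `wt X`. Requests at `p` are served without consulting `M`, whose
    -- history is therefore `off X Xs p h`.
    staying : ∀ {B D} p → Machine Xs B D → Machine (X ∷ Xs) (B ∘ off X Xs p) (wt X + D)
    staying {B} {D} p M = record
      { State = State′ ; start = λ (q , cs) → D , +-monoˡ-≤ D (dst≤wt X q p) , start cs ; step = step′ }
      where
      open Machine M
      State′ : List (Conf (X ∷ Xs)) → Conf (X ∷ Xs) → ℕ → Set
      State′ h (q , cs) y = ∃ λ y₀ → dst X q p + y₀ ≤ y × State (off X Xs p h) cs y₀
      step′ : ∀ {h c y} → State′ h c y → ∀ r →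
              (∃₂ λ c′ y′ → Hit (X ∷ Xs) r c′ × move (X ∷ Xs) c c′ + y′ ≤ y × State′ (r ∷ h) c′ y′)
              ⊎ B (off X Xs p (r ∷ h))
      step′ {c = q , cs} (y₀ , cost₀ , s) (ρ , rs) with ρ ≟ p
      ... | yes ρ≡p = inj₁ ((p , cs) , y₀ , inj₁ (sym ρ≡p) ,
        ≤-trans (≤-reflexive (cong (_+ y₀) (trans (cong (dst X q p +_) (move-refl Xs cs)) (+-identityʳ _)))) cost₀ ,
        y₀ , ≤-reflexive (cong (_+ y₀) (dst-refl X p)) , s)
      ... | no _ with step s rs
      ... | inj₂ bad = inj₂ bad
      ... | inj₁ (cs′ , y′ , x , cost , s′) = inj₁ ((p , cs′) , y′ , inj₂ x ,
        ≤-trans (≤-reflexive (+-assoc (dst X q p) _ y′)) (≤-trans (+-monoʳ-≤ (dst X q p) cost) cost₀) ,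
        y′ , ≤-reflexive (cong (_+ y′) (dst-refl X p)) , s′)

    -- Costliness survives longer histories, so points refuted in earlier stages stay refuted.
    testing : ∀ {D} → Machine Xs (λ h → ¬ Cheap Xs (wt X) h) D → ∀ ps →
              Machine (X ∷ Xs) (λ h → All (Costly X Xs h) ps) (length ps * (wt X + D))
    testing M [] = record { State = λ _ _ _ → ⊤ ; start = λ _ → tt ; step = λ _ _ → inj₂ [] }
    testing M (p ∷ ps) = staying p M then λ costly → relax
      (λ costlies j → Costly-⊆ X Xs (Join-⊆ˡ j) costly ∷ All.map (λ {q} → Costly-⊆ X Xs {p = q} (Join-⊆ʳ j)) costlies)
      (testing M ps)

    -- `capacity` many tests are budgeted whatever the number of candidates turns out to be; `endow`
    -- fills the gap. Points that are not candidates are costly already after the learning stage.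
    phase : ∀ {D D′} → Descending Xs →
            Machine Xs (λ h → ¬ Cheap Xs (patience X Xs) h) D → Machine Xs (λ h → ¬ Cheap Xs (wt X) h) D′ →
            Machine (X ∷ Xs) (λ h → ∀ p → Costly X Xs h p) (D + capacity (length Xs) * (wt X + D′))
    phase {D} {D′} desc learner tester = ignoring learner then λ {g} dear → endow
      (*-monoˡ-≤ (wt X + D′) (candidates-few X Xs desc g dear))
      (relax (λ costlies j p → costly costlies j p (candidates-complete X Xs g dear p))
             (testing tester (candidates X Xs g)))
      where
      costly : ∀ {g g′ h} → All (Costly X Xs g′) (candidates X Xs g) → Join g g′ h →
               ∀ p → Costly X Xs g p ⊎ p ∈ candidates X Xs g → Costly X Xs h p
      costly costlies j p (inj₁ costly-g) = Costly-⊆ X Xs (Join-⊆ˡ j) costly-g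
      costly costlies j p (inj₂ p∈)       = Costly-⊆ X Xs (Join-⊆ʳ j) (All.lookup costlies p∈)

    -- Blocks j g h: the history h consists of j completed phases and the current one, g.
    data Blocks : ℕ → List (Conf (X ∷ Xs)) → List (Conf (X ∷ Xs)) → Set where
      current : ∀ {g} → Blocks 0 g g
      closed  : ∀ {j r g₀ g h₀ h} → Blocks j (r ∷ g₀) h₀ → (∀ p → Costly X Xs (r ∷ g₀) p) → Join h₀ g h →
                Blocks (suc j) g h

    Blocks-∷ : ∀ {j g h} r → Blocks j g h → Blocks j (r ∷ g) (r ∷ h)
    Blocks-∷ r current                 = current
    Blocks-∷ r (closed blocks costly j) = closed blocks costly (next j)

    -- Every solution pays `wt X` on a completed phase, by `costly⇒wt≤free`; by `Join-free` these
    -- payments add up.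
    Blocks-free : ∀ {j g h S} → Blocks j g h → Served (X ∷ Xs) h S →
                  ∃ λ S′ → Served (X ∷ Xs) g S′ × j * wt X + free (move (X ∷ Xs)) S′ ≤ free (move (X ∷ Xs)) S
    Blocks-free current hits = _ , hits , ≤-refl
    Blocks-free {suc j} {S = S} (closed blocks costly join) hits
      with S₁ , S₂ , join′ , hits₁ , hits₂ ← Join-Pointwise join hits
      with S₁′ , hits₁′ , S₁≥ ← Blocks-free blocks hits₁ =
      S₂ , hits₂ , (begin
        wt X + j * wt X + f S₂   ≡⟨ cong (_+ f S₂) (+-comm (wt X) _) ⟩
        j * wt X + wt X + f S₂   ≤⟨ +-monoˡ-≤ (f S₂) (+-monoʳ-≤ (j * wt X) (costly⇒wt≤free X Xs costly hits₁′)) ⟩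
        j * wt X + f S₁′ + f S₂  ≤⟨ +-monoˡ-≤ (f S₂) S₁≥ ⟩
        f S₁ + f S₂              ≡⟨ Join-free (move (X ∷ Xs)) join′ ⟩
        f S                      ∎)
      where
      open ≤-Reasoning
      f = free (move (X ∷ Xs))

    -- Spending is at most `suc j * D` after `j` completed phases. These are charged to the solution
    -- by `Blocks-free`, and the additive `wt X` covers the current phase.
    forever : ∀ {D e} → D ≤ e * wt X → Machine (X ∷ Xs) (λ h → ∀ p → Costly X Xs h p) D →
              Forever (X ∷ Xs) e (wt X)
    forever {D} {e} D≤ M = record
      { State = State′
      ; start = λ c → 0 , [] , D , current , ≤-reflexive (sym (+-identityʳ D)) , start c
      ; step  = λ s r _ → step′ s r
      ; bound = bound′ }
      where
      open Machine M
      State′ : List (Conf (X ∷ Xs)) → Conf (X ∷ Xs) → ℕ → Set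
      State′ h c x = ∃ λ j → ∃₂ λ g y → Blocks j g h × x + y ≤ suc j * D × State g c y
      spend : ∀ x m {y y′} → m + y′ ≤ y → x + m + y′ ≤ x + y
      spend x m {y′ = y′} le = ≤-trans (≤-reflexive (+-assoc x m y′)) (+-monoʳ-≤ x le)
      step′ : ∀ {h c x} → State′ h c x → ∀ r →
              ∃ λ c′ → Hit (X ∷ Xs) r c′ × State′ (r ∷ h) c′ (x + move (X ∷ Xs) c c′)
      step′ {c = c} {x} (j , g , y , blocks , x+y≤ , s) r with step s r
      ... | inj₁ (c′ , y′ , hit , cost , s′) =
        c′ , hit , j , r ∷ g , y′ , Blocks-∷ r blocks , ≤-trans (spend x _ cost) x+y≤ , s′
      -- The machine restarts at the present configuration, and the request that ended the phase
      -- opens the next one.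
      ... | inj₂ costly with step (start c) r
      ... | inj₁ (c′ , y′ , hit , cost , s′) =
        c′ , hit , suc j , r ∷ [] , y′ , closed (Blocks-∷ r blocks) costly turn ,
        ≤-trans (spend x _ cost) (≤-trans (+-monoˡ-≤ D (≤-trans (m≤m+n x y) x+y≤)) (≤-reflexive (+-comm _ D))) , s′
      -- A single request can be served at cost 0, so it does not complete a phase.
      ... | inj₂ costly-[r] = contradiction
        (costly⇒wt≤free X Xs {S = r ∷ []} costly-[r] (inj₁ refl ∷ []))
        (<⇒≱ (wt>0 X))
      bound′ : ∀ {h c x S} → State′ h c x → Served (X ∷ Xs) h S → x ≤ e * (free (move (X ∷ Xs)) S + wt X)
      bound′ {x = x} {S} (j , g , y , blocks , x+y≤ , _) hits with S′ , _ , S≥ ← Blocks-free blocks hits = begin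
        x                                    ≤⟨ ≤-trans (m≤m+n x y) x+y≤ ⟩
        suc j * D                            ≤⟨ *-monoʳ-≤ (suc j) D≤ ⟩
        suc j * (e * wt X)                   ≡⟨ *-assoc (suc j) e (wt X) ⟨
        suc j * e * wt X                     ≡⟨ cong (_* wt X) (*-comm (suc j) e) ⟩
        e * suc j * wt X                     ≡⟨ *-assoc e (suc j) (wt X) ⟩
        e * (wt X + j * wt X)                ≡⟨ cong (e *_) (+-comm (wt X) _) ⟩
        e * (j * wt X + wt X)                ≤⟨ *-monoʳ-≤ e (+-monoˡ-≤ (wt X) (≤-trans (m≤m+n _ _) S≥)) ⟩
        e * (free (move (X ∷ Xs)) S + wt X)  ∎
        where open ≤-Reasoning

  -- Arithmetic of the competitive ratio.

  ratio : ℕ → ℕ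
  ratio l = 2 ^ (2 ^ (l + 3))

  capacity<2^2^ : ∀ l → suc (capacity l) ≤ 2 ^ (2 ^ l)
  capacity<2^2^ zero    = ≤-refl
  capacity<2^2^ (suc l) = begin
    suc (a * suc a)      ≤⟨ s≤s (m≤n+m (a * suc a) a) ⟩
    suc a * suc a        ≤⟨ *-mono-≤ (capacity<2^2^ l) (capacity<2^2^ l) ⟩
    2 ^ 2^l * 2 ^ 2^l    ≡⟨ ^-distribˡ-+-* 2 2^l 2^l ⟨
    2 ^ (2^l + 2^l)      ≡⟨ cong (λ z → 2 ^ (2^l + z)) (+-identityʳ 2^l) ⟨
    2 ^ (2 ^ suc l)      ∎
    where
    open ≤-Reasoning
    a = capacity l
    2^l = 2 ^ l

  ratio-suc : ∀ l → ratio l * ratio l ≡ ratio (suc l)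
  ratio-suc l = trans (sym (^-distribˡ-+-* 2 n n)) (cong (λ z → 2 ^ (n + z)) (sym (+-identityʳ n)))
    where n = 2 ^ (l + 3)

  n<2^n : ∀ n → n < 2 ^ n
  n<2^n zero    = z<s
  n<2^n (suc n) = begin-strict
    suc n         ≤⟨ n<2^n n ⟩
    2 ^ n         <⟨ m<m+n (2 ^ n) (m^n>0 2 n) ⟩
    2 ^ n + 2 ^ n ≡⟨ cong (2 ^ n +_) (+-identityʳ (2 ^ n)) ⟨
    2 ^ suc n     ∎
    where open ≤-Reasoning

  -- With `n = 2 ^ l` the two factors are at most `2 ^ n` and `2 ^ (6 * n)`, and
  -- `7 * n ≤ 8 * n = 2 ^ (l + 3)`; the 3 in the ratio gives this room.
  growth≤ratio : ∀ l → suc (capacity l) * (l + 5) ≤ ratio l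
  growth≤ratio l = begin
    suc (capacity l) * (l + 5)     ≤⟨ *-mono-≤ (capacity<2^2^ l) (<⇒≤ (n<2^n (l + 5))) ⟩
    2 ^ n * 2 ^ (l + 5)            ≡⟨ ^-distribˡ-+-* 2 n (l + 5) ⟨
    2 ^ (n + (l + 5))              ≤⟨ ^-monoʳ-≤ 2 (+-monoʳ-≤ n (+-mono-≤ (<⇒≤ (n<2^n l)) (*-monoʳ-≤ 5 (m^n>0 2 l)))) ⟩
    2 ^ (n + (n + 5 * n))          ≤⟨ ^-monoʳ-≤ 2 (≤-trans (≤-reflexive (sym (+-assoc n n (5 * n))))
                                        (+-monoˡ-≤ (5 * n) (+-monoʳ-≤ n (m≤m+n n (1 * n))))) ⟩
    2 ^ (3 * n + 5 * n)            ≡⟨ cong (2 ^_) (*-distribʳ-+ n 3 5) ⟨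
    2 ^ (8 * n)                    ≡⟨ cong (2 ^_) (trans (*-comm 8 n) (sym (^-distribˡ-+-* 2 l 3))) ⟩
    ratio l                        ∎
    where
    open ≤-Reasoning
    n = 2 ^ l

  -- The first summand is the learning stage, run up to `patience`, the second the tests of at most
  -- `a` candidates. Once `W` is raised to `w`, `a` to `suc a` and a single `w` to `e * w`, learning
  -- contributes `l + 2` and testing 3 to the factor `l + 5`.
  phase-cost : ∀ l {w W} → W ≤ w → let e = ratio l ; a = capacity l in
               e * (suc l * (suc a * w) + W) + a * (w + e * (w + W)) ≤ ratio (suc l) * w
  phase-cost l {w} {W} W≤w = begin
    e * (suc l * (suc a * w) + W) + a * (w + e * (w + W))
      ≤⟨ +-mono-≤ (*-monoʳ-≤ e (+-monoʳ-≤ (suc l * (suc a * w)) (≤-trans W≤w (m≤m+n w (a * w)))))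
                  (*-mono-≤ (n≤1+n a) (+-mono-≤ (m≤n*m w e) (*-monoʳ-≤ e (+-monoʳ-≤ w W≤w)))) ⟩
    e * (suc l * (suc a * w) + suc a * w) + suc a * (e * w + e * (w + w))
      ≡⟨ solve 4 (λ e l a w → e :* ((con 1 :+ l) :* (a :* w) :+ a :* w) :+ a :* (e :* w :+ e :* (w :+ w))
                           := e :* (a :* (l :+ con 5)) :* w) refl e l (suc a) w ⟩
    e * (suc a * (l + 5)) * w
      ≤⟨ *-monoˡ-≤ w (*-monoʳ-≤ e (growth≤ratio l)) ⟩
    e * e * w
      ≡⟨ cong (_* w) (ratio-suc l) ⟩
    ratio (suc l) * w ∎
    where
    open ≤-Reasoning
    open +-*-Solver
    e = ratio l
    a = capacity l
    instance
      e≢0 : NonZero e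
      e≢0 = m^n≢0 2 (2 ^ (l + 3))

  -- Induction on the number of spaces.

  heaviest : List Space → ℕ
  heaviest []      = 0
  heaviest (X ∷ _) = wt X

  heaviest≤ : ∀ {w Xs} → All (λ Y → wt Y ≤ w) Xs → heaviest Xs ≤ w
  heaviest≤ []       = z≤n
  heaviest≤ (le ∷ _) = le

  -- The algorithm for the lighter spaces is used with two thresholds, `patience` for learning and
  -- `wt X` for testing. Without spaces no request can be served, so nothing is ever spent.
  online : ∀ Xs → Descending Xs → Forever Xs (ratio (length Xs)) (heaviest Xs)
  online [] [] = record
    { State = λ _ _ x → x ≡ 0
    ; start = λ _ → refl
    ; step  = λ where _ _ (_ , ())
    ; bound = λ where refl _ → z≤n }
  online (X ∷ Xs) (X≥Xs ∷ desc) = forever X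
    (phase-cost (length Xs) (heaviest≤ X≥Xs))
    (phase X desc (truncate (patience X Xs) (0<patience X Xs) lighter) (truncate (wt X) (wt>0 X) lighter))
    where lighter = online Xs desc

open Discrete

-- Clearing the denominators of rational weights.

module Scaling where
  open import Data.Nat using (ℕ; zero; suc; s≤s; z≤n)
  import Data.Nat as ℕ
  import Data.Nat.Properties as ℕ
  open import Data.Integer as ℤ using (+_; +[1+_])
  import Data.Integer.Properties as ℤ
  open import Data.Rational.Unnormalised as ℚᵘ using (mkℚᵘ; *≡*; *≤*)
  import Data.Rational.Unnormalised.Properties as ℚᵘ
  open import Data.Rational
  open import Data.Rational.Properties
  open import Data.Fin using (Fin; zero; suc)
  open import Data.Product
  open import Relation.Binary.PropositionalEquality

  scaled : ℕ → ℕ → ℚ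
  scaled e n = + n / suc e

  scaled-ᵘ : ∀ e n → toℚᵘ (scaled e n) ℚᵘ.≃ mkℚᵘ (+ n) e
  scaled-ᵘ e n = toℚᵘ-fromℚᵘ (mkℚᵘ (+ n) e)

  scaled-cross : ∀ {e f} m n → m ℕ.* suc f ≡ n ℕ.* suc e → scaled e m ≡ scaled f n
  scaled-cross {e} {f} m n eq = fromℚᵘ-cong {mkℚᵘ (+ m) e} {mkℚᵘ (+ n) f}
    (*≡* (trans (sym (ℤ.pos-* m (suc f))) (trans (cong +_ eq) (ℤ.pos-* n (suc e)))))

  scaled-0 : ∀ e → scaled e 0 ≡ 0ℚ
  scaled-0 e = scaled-cross {e} {0} 0 0 refl

  scaled-+ : ∀ e m n → scaled e (m ℕ.+ n) ≡ scaled e m + scaled e n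
  scaled-+ e m n = toℚᵘ-injective (begin-equality
    toℚᵘ (scaled e (m ℕ.+ n))                       ≃⟨ scaled-ᵘ e (m ℕ.+ n) ⟩
    mkℚᵘ (+ (m ℕ.+ n)) e                            ≃⟨ *≡* cross ⟩
    mkℚᵘ (+ m) e ℚᵘ.+ mkℚᵘ (+ n) e                  ≃⟨ ℚᵘ.+-cong (scaled-ᵘ e m) (scaled-ᵘ e n) ⟨
    toℚᵘ (scaled e m) ℚᵘ.+ toℚᵘ (scaled e n)        ≃⟨ toℚᵘ-homo-+ (scaled e m) (scaled e n) ⟨
    toℚᵘ (scaled e m + scaled e n)                  ∎)
    where
    open ℚᵘ.≤-Reasoning
    d = + suc e
    cross : + (m ℕ.+ n) ℤ.* (d ℤ.* d) ≡ (+ m ℤ.* d ℤ.+ + n ℤ.* d) ℤ.* d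
    cross = trans (sym (ℤ.*-assoc (+ (m ℕ.+ n)) d d))
      (cong (ℤ._* d) (trans (cong (ℤ._* d) (ℤ.pos-+ m n)) (ℤ.*-distribʳ-+ d (+ m) (+ n))))

  scaled-* : ∀ e m n → scaled e (m ℕ.* n) ≡ (+ m / 1) * scaled e n
  scaled-* e m n = toℚᵘ-injective (begin-equality
    toℚᵘ (scaled e (m ℕ.* n))                       ≃⟨ scaled-ᵘ e (m ℕ.* n) ⟩
    mkℚᵘ (+ (m ℕ.* n)) e                            ≃⟨ *≡* (cong₂ ℤ._*_ (ℤ.pos-* m n) (cong (λ f → +[1+ f ]) (ℕ.+-identityʳ e))) ⟩
    mkℚᵘ (+ m) 0 ℚᵘ.* mkℚᵘ (+ n) e                  ≃⟨ ℚᵘ.*-cong (scaled-ᵘ 0 m) (scaled-ᵘ e n) ⟨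
    toℚᵘ (+ m / 1) ℚᵘ.* toℚᵘ (scaled e n)           ≃⟨ toℚᵘ-homo-* (+ m / 1) (scaled e n) ⟨
    toℚᵘ ((+ m / 1) * scaled e n)                   ∎)
    where open ℚᵘ.≤-Reasoning

  scaled-mono : ∀ e {m n} → m ℕ.≤ n → scaled e m ≤ scaled e n
  scaled-mono e {m} {n} m≤n = toℚᵘ-cancel-≤ (begin
    toℚᵘ (scaled e m) ≃⟨ scaled-ᵘ e m ⟩
    mkℚᵘ (+ m) e      ≤⟨ *≤* (ℤ.*-monoʳ-≤-nonNeg +[1+ e ] (ℤ.+≤+ m≤n)) ⟩
    mkℚᵘ (+ n) e      ≃⟨ scaled-ᵘ e n ⟨
    toℚᵘ (scaled e n) ∎)
    where open ℚᵘ.≤-Reasoning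

  positive-scaled : ∀ q → 0ℚ < q → ∃₂ λ e m → q ≡ scaled e (suc m)
  positive-scaled q@(mkℚ +[1+ m ] e _) _ = e , m , sym (fromℚᵘ-toℚᵘ q)
  positive-scaled (mkℚ (+ 0) _ _) (*<* (ℤ.+<+ ()))
  positive-scaled (mkℚ (ℤ.-[1+ _ ]) _ _) (*<* ())

  common-scale : ∀ k (w : Fin k → ℚ) → (∀ i → 0ℚ < w i) →
                 ∃₂ λ e (W : Fin k → ℕ) → (∀ i → w i ≡ scaled e (W i)) × (∀ i → 0 ℕ.< W i)
  common-scale zero    w w>0 = 0 , (λ ()) , (λ ()) , (λ ())
  common-scale (suc k) w w>0
    with e , W , w≡ , W>0 ← common-scale k (λ i → w (suc i)) (λ i → w>0 (suc i))
       -- The successor of the new scale is `suc e * suc f`, the product of the two denominators.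
       | f , m , w₀≡ ← positive-scaled (w zero) (w>0 zero) = f ℕ.+ e ℕ.* suc f , W′ , w≡′ , W′>0
    where
    W′ : Fin (suc k) → ℕ
    W′ zero    = suc m ℕ.* suc e
    W′ (suc i) = W i ℕ.* suc f
    w≡′ : ∀ i → w i ≡ scaled (f ℕ.+ e ℕ.* suc f) (W′ i)
    w≡′ zero    = trans w₀≡ (scaled-cross (suc m) (W′ zero) (sym (ℕ.*-assoc (suc m) (suc e) (suc f))))
    w≡′ (suc i) = trans (w≡ i) (scaled-cross (W i) (W′ (suc i))
      (trans (cong (W i ℕ.*_) (ℕ.*-comm (suc e) (suc f))) (sym (ℕ.*-assoc (W i) (suc f) (suc e)))))
    W′>0 : ∀ i → 0 ℕ.< W′ i
    W′>0 zero    = s≤s z≤n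
    W′>0 (suc i) = ℕ.<-≤-trans (W>0 i) (ℕ.m≤m*n (W i) (suc f))

open import Defs
open import Data.Nat using (ℕ; _≤_) renaming (_<_ to _<ℕ_)
open import Data.Fin using (Fin)
open import Data.Rational using (ℚ; 0ℚ; _<_; _+_; _*_) renaming (_≤_ to _≤ℚ_)
open import Data.List using (List)
open import Data.List.Relation.Binary.Pointwise using (Pointwise)
open import Data.Product using (Σ; ∃; _×_; _,_)
open import Relation.Binary.Definitions using (DecidableEquality)
open import Relation.Binary.PropositionalEquality using (_≡_)

-- Transfer to indexed servers and rational costs.

module Transfer (k : ℕ) (1≤k : 1 ≤ k) (P : Fin k → Set) (eq : (i : Fin k) → DecidableEquality (P i))
                (w : Fin k → ℚ) (c₀ : Config k P) (e : ℕ) (W : Fin k → ℕ)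
                (w≡ : ∀ i → w i ≡ Scaling.scaled e (W i)) (W>0 : ∀ i → 0 <ℕ W i) where
  open import Algebra.Bundles using (CommutativeMonoid)
  import Data.Nat as ℕ
  import Data.Nat.Properties as ℕ
  open import Data.Nat using (suc)
  open import Data.Fin as Fin using (zero; suc)
  import Data.Rational.Properties as ℚ
  open import Data.List using ([]; _∷_; map; foldl; foldr; length; allFin; tabulate; _ʳ++_; _∷ʳ_)
  open import Data.List.Properties using (foldl-∷ʳ; length-map; length-tabulate)
  open import Data.List.Membership.Propositional using (_∈_)
  open import Data.List.Membership.Propositional.Properties using (∈-allFin)
  open import Data.List.Relation.Binary.Permutation.Propositional using (_↭_; refl; prep; swap; trans; ↭-sym; ↭⇒↭ₛ)
  open import Data.List.Relation.Binary.Permutation.Propositional.Properties using (↭-length; ∈-resp-↭)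
  import Data.List.Relation.Binary.Permutation.Setoid.Properties as Permutationₛ
  open import Data.List.Relation.Binary.Pointwise as Pointwise using ([]; _∷_)
  open import Data.List.Relation.Unary.All using (All; []; _∷_)
  open import Data.List.Relation.Unary.AllPairs using ([]; _∷_)
  import Data.List.Relation.Unary.AllPairs.Properties as AllPairs
  open import Data.List.Relation.Unary.Any using (here; there)
  open import Data.List.Relation.Unary.Linked.Properties using (Linked⇒AllPairs)
  open import Data.List.Relation.Unary.Unique.Propositional using (Unique)
  open import Data.List.Relation.Unary.Unique.Propositional.Properties using (allFin⁺)
  import Data.List.Sort as Sort
  open import Data.Product using (proj₁; proj₂)
  open import Data.Sum using (inj₁; inj₂)
  open import Data.Unit using (tt)
  open import Relation.Nullary using (yes; no; contradiction)
  import Relation.Binary.Construct.On as On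
  import Relation.Binary.Construct.Flip.EqAndOrd as Flip
  open import Relation.Binary.PropositionalEquality
    using (_≢_; refl; sym; cong; cong₂; subst; setoid; module ≡-Reasoning)
    renaming (trans to infixr 4 _⊚_)
  open Scaling

  ι : ℕ → ℚ
  ι = scaled e

  space : Fin k → Space
  space i = record { Pt = P i ; _≟_ = eq i ; wt = W i ; wt>0 = W>0 i }

  -- The order is flipped to put the heaviest server first, as `Descending` asks.
  open Sort (On.decTotalOrder (Flip.decTotalOrder ℕ.≤-decTotalOrder) W) using (sort; sort-↭; sort-↗)

  L : List (Fin k)
  L = sort (allFin k)

  Xs : List Space
  Xs = map space L

  Xs-descending : Descending Xs
  Xs-descending = AllPairs.map⁺
    (Linked⇒AllPairs (λ j≤i l≤j → ℕ.≤-trans l≤j j≤i) (sort-↗ (allFin k)))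

  L-unique : Unique L
  L-unique = Permutationₛ.Unique-resp-↭ (setoid (Fin k)) (↭⇒↭ₛ (↭-sym (sort-↭ (allFin k)))) (allFin⁺ k)

  ∈-L : ∀ i → i ∈ L
  ∈-L i = ∈-resp-↭ (↭-sym (sort-↭ (allFin k))) (∈-allFin i)

  length-Xs : length Xs ≡ k
  length-Xs = length-map space L ⊚ ↭-length (sort-↭ (allFin k)) ⊚ length-tabulate (λ i → i)

  encode : ∀ is → Config k P → Conf (map space is)
  encode []       c = tt
  encode (i ∷ is) c = c i , encode is c

  assign : Config k P → (i : Fin k) → P i → Config k P
  assign c i x j with j Fin.≟ i
  ... | yes refl = x
  ... | no _     = c j

  -- The base value `c₀` leaves no trace when `is` is `L`: every index occurs there, so each
  -- coordinate is overwritten.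
  decode : ∀ is → Conf (map space is) → Config k P
  decode []       _       = c₀
  decode (i ∷ is) (x , h) = assign (decode is h) i x

  assign-here : ∀ c i x → assign c i x i ≡ x
  assign-here c i x with i Fin.≟ i
  ... | yes refl = refl
  ... | no i≢i   = contradiction refl i≢i

  encode-assign : ∀ is c i x → All (i ≢_) is → encode is (assign c i x) ≡ encode is c
  encode-assign []       c i x []            = refl
  encode-assign (j ∷ is) c i x (i≢j ∷ i≢is) = cong₂ _,_ (there-≡ j i≢j) (encode-assign is c i x i≢is)
    where
    there-≡ : ∀ j → i ≢ j → assign c i x j ≡ c j
    there-≡ j i≢j with j Fin.≟ i
    ... | yes refl = contradiction refl i≢j
    ... | no _     = refl

  encode-decode : ∀ is → Unique is → ∀ h → encode is (decode is h) ≡ h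
  encode-decode []       []             _       = refl
  encode-decode (i ∷ is) (i≢is ∷ uniq) (x , h) = cong₂ _,_ (assign-here (decode is h) i x)
    (encode-assign is (decode is h) i x i≢is ⊚ encode-decode is uniq h)

  hit⇒serves : ∀ is {r c} → Hit (map space is) (encode is r) (encode is c) → Serves k P r c
  hit⇒serves (i ∷ is) (inj₁ c≡r) = i , c≡r
  hit⇒serves (i ∷ is) (inj₂ h)   = hit⇒serves is h

  serves⇒hit : ∀ {is i r c} → i ∈ is → c i ≡ r i → Hit (map space is) (encode is r) (encode is c)
  serves⇒hit (here refl) c≡r = inj₁ c≡r
  serves⇒hit (there i∈)  c≡r = inj₂ (serves⇒hit i∈ c≡r)

  sumOver : (Fin k → ℚ) → List (Fin k) → ℚ
  sumOver f = foldr (λ i s → f i + s) 0ℚ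

  sumOver-↭ : ∀ f {is js} → is ↭ js → sumOver f is ≡ sumOver f js
  sumOver-↭ f refl         = refl
  sumOver-↭ f (prep i p)   = cong (f i +_) (sumOver-↭ f p)
  sumOver-↭ f (swap {xs = is} {js} i j p) = begin
    f i + (f j + sumOver f is) ≡⟨ x∙yz≈y∙xz (f i) (f j) _ ⟩
    f j + (f i + sumOver f is) ≡⟨ cong (λ s → f j + (f i + s)) (sumOver-↭ f p) ⟩
    f j + (f i + sumOver f js) ∎
    where
    open ≡-Reasoning
    open import Algebra.Properties.CommutativeSemigroup
      (CommutativeMonoid.commutativeSemigroup ℚ.+-0-commutativeMonoid) using (x∙yz≈y∙xz)
  sumOver-↭ f (trans p q)  = sumOver-↭ f p ⊚ sumOver-↭ f q

  sumOver-tabulate : ∀ f n (g : Fin n → Fin k) → sumOver f (tabulate g) ≡ sumFin n (λ i → f (g i))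
  sumOver-tabulate f 0       g = refl
  sumOver-tabulate f (suc n) g = cong (f (g zero) +_) (sumOver-tabulate f n (λ i → g (suc i)))

  dist-ι : ∀ i x y → dist k P eq w i x y ≡ ι (dst (space i) x y)
  dist-ι i x y with eq i x y
  ... | yes _ = sym (scaled-0 e)
  ... | no _  = w≡ i

  moveOver-ι : ∀ is c c′ → ι (move (map space is) (encode is c) (encode is c′))
                         ≡ sumOver (λ i → dist k P eq w i (c i) (c′ i)) is
  moveOver-ι []       c c′ = scaled-0 e
  moveOver-ι (i ∷ is) c c′ = scaled-+ e (dst (space i) (c i) (c′ i)) _
    ⊚ cong₂ _+_ (sym (dist-ι i (c i) (c′ i))) (moveOver-ι is c c′)

  moveCost-ι : ∀ c c′ → moveCost k P eq w c c′ ≡ ι (move Xs (encode L c) (encode L c′))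
  moveCost-ι c c′ = sym (moveOver-ι L c c′ ⊚ sumOver-↭ f (sort-↭ (allFin k)) ⊚ sumOver-tabulate f k (λ i → i))
    where f = λ i → dist k P eq w i (c i) (c′ i)

  pathCost-ι : ∀ c S → pathCost k P eq w c S ≡ ι (path (move Xs) (encode L c) (map (encode L) S))
  pathCost-ι c []      = sym (scaled-0 e)
  pathCost-ι c (d ∷ S) = cong₂ _+_ (moveCost-ι c d) (pathCost-ι d S)
    ⊚ sym (scaled-+ e (move Xs (encode L c) (encode L d)) _)

  open Forever (online Xs Xs-descending)

  record Snapshot : Set where
    constructor snapshot
    field
      {history} : List (Conf Xs)
      {position} : Conf Xs
      {spent}   : ℕ
      state     : State history position spent
  open Snapshot

  advance-step : (s : Snapshot) (r : Request k P) →
    ∃ λ c → Hit Xs (encode L r) c × State (encode L r ∷ history s) c (spent s ℕ.+ move Xs (position s) c)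
  -- As `k` is positive, the request itself, taken as a configuration, serves the request.
  advance-step s r = step (state s) (encode L r) (encode L r , serves⇒hit (∈-L (Fin.fromℕ< 1≤k)) refl)

  advance : Snapshot → Request k P → Snapshot
  advance s r = snapshot (proj₂ (proj₂ (advance-step s r)))

  initial : Snapshot
  initial = snapshot (start (encode L c₀))

  -- `OnlineAlg` provides no memory, so the state is recomputed from the past requests at each call.
  algorithm : OnlineAlg k P
  algorithm past r = decode L (position (advance (foldl advance initial past) r))

  encode-algorithm : ∀ past r → encode L (algorithm past r) ≡ position (advance (foldl advance initial past) r)
  encode-algorithm past r = encode-decode L L-unique _

  algorithm-serves : ∀ past r → Serves k P r (algorithm past r)
  algorithm-serves past r = hit⇒serves L (subst (Hit Xs (encode L r)) (sym (encode-algorithm past r))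
    (proj₁ (proj₂ (advance-step (foldl advance initial past) r))))

  history-foldl : ∀ s σ → history (foldl advance s σ) ≡ map (encode L) σ ʳ++ history s
  history-foldl s []      = refl
  history-foldl s (r ∷ σ) = history-foldl (advance s r) σ

  runFrom-ι : ∀ past σ c → encode L c ≡ position (foldl advance initial past) →
              ι (spent (foldl advance initial past)) + pathCost k P eq w c (runFrom k P algorithm past σ)
              ≡ ι (spent (foldl advance (foldl advance initial past) σ))
  runFrom-ι past []      c c≡ = ℚ.+-identityʳ _
  runFrom-ι past (r ∷ σ) c c≡ = begin
    ι (spent s) + (moveCost k P eq w c c′ + rest)  ≡⟨ ℚ.+-assoc (ι (spent s)) _ _ ⟨
    ι (spent s) + moveCost k P eq w c c′ + rest    ≡⟨ cong (λ q → ι (spent s) + q + rest) (moveCost-ι c c′) ⟩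
    ι (spent s) + ι (move Xs (encode L c) (encode L c′)) + rest
      ≡⟨ cong₂ (λ a b → ι (spent s) + ι (move Xs a b) + rest) c≡ (encode-algorithm past r) ⟩
    ι (spent s) + ι (move Xs (position s) (position s′)) + rest
      ≡⟨ cong (_+ rest) (scaled-+ e (spent s) _) ⟨
    ι (spent s′) + rest                            ≡⟨ cong (λ s → ι (spent s) + rest) s′≡ ⟨
    ι (spent (foldl advance initial (past ∷ʳ r))) + rest
      ≡⟨ runFrom-ι (past ∷ʳ r) σ c′ (encode-algorithm past r ⊚ sym (cong position s′≡)) ⟩
    ι (spent (foldl advance (foldl advance initial (past ∷ʳ r)) σ))
      ≡⟨ cong (λ s → ι (spent (foldl advance s σ))) s′≡ ⟩
    ι (spent (foldl advance s′ σ)) ∎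
    where
    open ≡-Reasoning
    s    = foldl advance initial past
    s′   = advance s r
    c′   = algorithm past r
    rest = pathCost k P eq w c′ (runFrom k P algorithm (past ∷ʳ r) σ)
    s′≡ : foldl advance initial (past ∷ʳ r) ≡ s′
    s′≡ = foldl-∷ʳ advance initial r past

  -- Relates newest-first histories to chronological solutions: both parts meet at `c`, and symmetry
  -- of `move` allows the reversed part to be traversed backwards.
  free-ʳ++ : ∀ S c acc → free (move Xs) (S ʳ++ (c ∷ acc)) ≡ path (move Xs) c S ℕ.+ path (move Xs) c acc
  free-ʳ++ []      c acc = refl
  free-ʳ++ (d ∷ S) c acc = begin
    free (move Xs) (S ʳ++ (d ∷ c ∷ acc))                             ≡⟨ free-ʳ++ S d (c ∷ acc) ⟩
    path (move Xs) d S ℕ.+ (move Xs d c ℕ.+ path (move Xs) c acc)    ≡⟨ ℕ.+-assoc (path (move Xs) d S) _ _ ⟨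
    path (move Xs) d S ℕ.+ move Xs d c ℕ.+ path (move Xs) c acc      ≡⟨ cong (ℕ._+ path (move Xs) c acc)
      (ℕ.+-comm (path (move Xs) d S) _ ⊚ cong (ℕ._+ path (move Xs) d S) (move-sym Xs d c)) ⟩
    move Xs c d ℕ.+ path (move Xs) d S ℕ.+ path (move Xs) c acc      ∎
    where open ≡-Reasoning

  free-reversed : ∀ S → free (move Xs) (S ʳ++ []) ℕ.≤ path (move Xs) (encode L c₀) S
  free-reversed []      = ℕ.z≤n
  free-reversed (d ∷ S) = ℕ.≤-trans (ℕ.≤-reflexive (free-ʳ++ S d [] ⊚ ℕ.+-identityʳ _)) (ℕ.m≤n+m _ (move Xs (encode L c₀) d))

  served-reversed : ∀ {σ S} → Pointwise (Serves k P) σ S →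
                    Served Xs (map (encode L) σ ʳ++ []) (map (encode L) S ʳ++ [])
  served-reversed hits = Pointwise.ʳ++⁺
    (Pointwise.map⁺ (encode L) (encode L) (Pointwise.map (λ (i , c≡r) → serves⇒hit (∈-L i) c≡r) hits)) []

  competitive : ∀ σ S → Pointwise (Serves k P) σ S →
                pathCost k P eq w c₀ (run k P algorithm σ)
                  ≤ℚ ratioBound k * pathCost k P eq w c₀ S + ratioBound k * ι (heaviest Xs)
  competitive σ S hits = begin
    pathCost k P eq w c₀ (run k P algorithm σ)
      ≡⟨ ℚ.+-identityˡ _ ⟨
    0ℚ + pathCost k P eq w c₀ (run k P algorithm σ)
      ≡⟨ cong (_+ pathCost k P eq w c₀ (run k P algorithm σ)) (scaled-0 e) ⟨
    ι 0 + pathCost k P eq w c₀ (run k P algorithm σ)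
      ≡⟨ runFrom-ι [] σ c₀ refl ⟩
    ι (spent final)
      ≤⟨ scaled-mono e (bound (state final) final-served) ⟩
    ι (ratio (length Xs) ℕ.* (free (move Xs) (map (encode L) S ʳ++ []) ℕ.+ heaviest Xs))
      ≤⟨ scaled-mono e (ℕ.*-monoʳ-≤ (ratio (length Xs)) (ℕ.+-monoˡ-≤ (heaviest Xs) (free-reversed (map (encode L) S)))) ⟩
    ι (ratio (length Xs) ℕ.* (opt ℕ.+ heaviest Xs))
      ≡⟨ cong (λ l → ι (ratio l ℕ.* (opt ℕ.+ heaviest Xs))) length-Xs ⟩
    ι (ratio k ℕ.* (opt ℕ.+ heaviest Xs))
      ≡⟨ scaled-* e (ratio k) _ ⟩
    ratioBound k * ι (opt ℕ.+ heaviest Xs)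
      ≡⟨ cong (ratioBound k *_) (scaled-+ e opt (heaviest Xs)) ⟩
    ratioBound k * (ι opt + ι (heaviest Xs))
      ≡⟨ ℚ.*-distribˡ-+ (ratioBound k) (ι opt) (ι (heaviest Xs)) ⟩
    ratioBound k * ι opt + ratioBound k * ι (heaviest Xs)
      ≡⟨ cong (λ q → ratioBound k * q + ratioBound k * ι (heaviest Xs)) (pathCost-ι c₀ S) ⟨
    ratioBound k * pathCost k P eq w c₀ S + ratioBound k * ι (heaviest Xs) ∎
    where
    open ℚ.≤-Reasoning
    final = foldl advance initial σ
    opt = path (move Xs) (encode L c₀) (map (encode L) S)
    final-served : Served Xs (history final) (map (encode L) S ʳ++ [])
    final-served = subst (λ h → Served Xs h (map (encode L) S ʳ++ [])) (sym (history-foldl initial σ)) (served-reversed hits)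

theorem3 : (k : ℕ) → 1 ≤ k →
    (P : Fin k → Set) → (eq : (i : Fin k) → DecidableEquality (P i)) →
    (w : Fin k → ℚ) → ((i : Fin k) → 0ℚ < w i) →
    (c₀ : Config k P) →
    Σ (OnlineAlg k P) λ A →
    ((h : List (Request k P)) (r : Request k P) → Serves k P r (A h r))
    × ∃ λ (a : ℚ) →
    (σ : List (Request k P)) (S : List (Config k P)) →
    Pointwise (Serves k P) σ S →
    pathCost k P eq w c₀ (run k P A σ)
    ≤ℚ ratioBound k * pathCost k P eq w c₀ S + a
theorem3 k 1≤k P eq w w>0 c₀ with e , W , w≡ , W>0 ← Scaling.common-scale k w w>0 =
  algorithm , algorithm-serves , ratioBound k * Scaling.scaled e (heaviest Xs) , competitive
  where open Transfer k 1≤k P eq w c₀ e W w≡ W>0
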